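{- Let $k\ge 1$. For all $\Upsilon\subseteq\mathcal{F}_{2,k}$, $$D^{\Upsilon}(x,t)=\frac{1-x}{1-x+\sum_{n\ge 1}\frac{((x-1)t)^n}{(kn)!}\,full^{\Upsilon}_n},$$ where $$D^{\Upsilon}(x,t)=1+\sum_{n\ge 1}\frac{t^n}{(kn)!}\sum_{F\in\mathcal{F}_{n,k}}x^{\Upsilon\text{ -mch}(F)}.$$
   Context: $\mathcal{F}_{n,k}$ is the set of all fillings $F$ of the $k\times n$ rectangular array ($k$ rows, $n$ columns) with the integers $1,\dots,kn$, each used once, such that the elements in each column increase from bottom to top. $F(i,j)$ is the entry in the $i$-th row from the bottom and $j$-th column from the left. For a filling of a $k\times n$ array by distinct positive integers with columns increasing from bottom to top, $\mathrm{red}(F)\in\mathcal{F}_{n,k}$ is obtained by replacing the $i$-th smallest entry by $i$. $F[c_1,\dots,c_j]$ is the filling of the $k\times j$ array whose $a$-th column is column $c_a$ of $F$. For $\Upsilon\subseteq\mathcal{F}_{2,k}$, $F\in\mathcal{F}_{n,k}$ has an $\Upsilon$-match starting at position $i$ ($1\le i\le n-1$) if $\mathrm{red}(F[i,i+1])\in\Upsilon$. $\Upsilon\text{ -mch}(F)$ is the number of $\Upsilon$-matches in $F$. $full^{\Upsilon}_n$ is the number of $F\in\mathcal{F}_{n,k}$ with $\Upsilon\text{ -mch}(F)=n-1$ (i.e. with $\Upsilon$-matches starting at every position $1,\dots,n-1$), with $full^{\Upsilon}_1=1$ by convention. The identity is one of formal power series in $t$ with coefficients in $\mathbb{Q}(x)$.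 -}

module Defs where

open import Level using (Level; 0ℓ)
open import Algebra.Bundles.Raw using (RawRing)
import Algebra.Definitions.RawSemiring as RawSemiringDefs
open import Data.Empty using (⊥-elim)
open import Data.Fin.Base using (Fin; zero; suc; toℕ; inject₁)
open import Data.Integer.Base using (+_)
open import Data.List.Base as List
  using (List; []; _∷_; _++_; upTo; allFin; filter; length; foldr; cartesianProductWith)
open import Data.List.Membership.DecPropositional using (_∈?_)
open import Data.List.Membership.Propositional.Properties using (∈-∃++)
open import Data.List.Relation.Binary.Permutation.Propositional
  using (_↭_; ↭-refl; ↭-sym; ↭-trans; prep)
open import Data.List.Relation.Binary.Permutation.Propositional.Properties
  using (∈-resp-↭; drop-∷; shift; ¬x∷xs↭[])
open import Data.List.Relation.Unary.Any using (here)
open import Data.Nat.Base as ℕ using (ℕ; zero; suc; _∸_; _<_; _!; NonZero)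
import Data.Nat.Properties as ℕ
open import Data.Product.Base using (_×_; _,_)
open import Data.Rational.Base as ℚ using (ℚ; 0ℚ; 1ℚ)
import Data.Rational.Properties as ℚ
open import Data.Vec.Base as Vec using (Vec; []; _∷_; lookup; toList; concat)
open import Data.Vec.Relation.Unary.All as All using (All)
open import Data.Vec.Relation.Unary.AllPairs as AllPairs using (AllPairs)
open import Relation.Binary.PropositionalEquality
  using (_≡_; _≢_; refl; sym; trans; cong; cong₂)
open import Relation.Nullary using (¬_; Dec; yes; no; _×-dec_)
open import Relation.Unary using (Pred; Decidable; _∈_)

-- An array with k rows and n columns, stored as its list of columns from left
-- to right, each column read from bottom to top.
Array : ℕ → ℕ → Set
Array n k = Vec (Vec ℕ k) n

private
  variable
    m n k j : ℕ
    ℓ : Level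

entries : Array n k → List ℕ
entries F = toList (concat F)

[1⋯_] : ℕ → List ℕ
[1⋯ N ] = List.map suc (upTo N)

IsFilling : Pred (Array n k) 0ℓ
IsFilling {n} {k} F = entries F ↭ [1⋯ k ℕ.* n ] × All (AllPairs _<_) F

_↭?_ : (xs ys : List ℕ) → Dec (xs ↭ ys)
[] ↭? [] = yes ↭-refl
[] ↭? (y ∷ ys) = no λ p → ¬x∷xs↭[] (↭-sym p)
(x ∷ xs) ↭? ys with _∈?_ ℕ._≟_ x ys
... | no x∉ys = no λ p → x∉ys (∈-resp-↭ p (here refl))
... | yes x∈ys with ∈-∃++ x∈ys
... | as , bs , refl with xs ↭? (as ++ bs)
... | yes p = yes (↭-trans (prep x p) (↭-sym (shift x as bs)))
... | no ¬p = no λ q → ¬p (drop-∷ (↭-trans q (shift x as bs)))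

isFilling? : Decidable (IsFilling {n} {k})
isFilling? {n} {k} F =
  (entries F ↭? [1⋯ k ℕ.* n ]) ×-dec All.all? (AllPairs.allPairs? ℕ._<?_) F

vectors : {A : Set} → List A → ∀ n → List (Vec A n)
vectors as zero    = [] ∷ []
vectors as (suc n) = cartesianProductWith _∷_ as (vectors as n)

-- An enumeration without repetition of the fillings of the k × n array.
𝓕 : ∀ n k → List (Array n k)
𝓕 n k = filter isFilling? (vectors (vectors [1⋯ k ℕ.* n ] k) n)

-- When the entries of F are distinct, an entry is the i-th smallest one
-- exactly when i entries are less than or equal to it.
red : Array n k → Array n k
red F = Vec.map (Vec.map λ a → length (filter (ℕ._≤? a) (entries F))) F

_[_] : Array n k → Vec (Fin n) j → Array j k
F [ cs ] = Vec.map (lookup F) cs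

Match : Pred (Array 2 k) ℓ → Array (suc m) k → Pred (Fin m) ℓ
Match Υ F i = red (F [ inject₁ i ∷ suc i ∷ [] ]) ∈ Υ

module _ {Υ : Pred (Array 2 k) ℓ} (Υ? : Decidable Υ) where

  match? : (F : Array (suc m) k) → Decidable (Match Υ F)
  match? F i = Υ? (red (F [ inject₁ i ∷ suc i ∷ [] ]))

  mch : Array (suc m) k → ℕ
  mch {m} F = length (filter (match? F) (allFin m))

  full : (n : ℕ) .{{_ : NonZero n}} → ℕ
  full 1               = 1
  full (suc m@(suc _)) = length (filter (λ F → mch F ℕ.≟ m) (𝓕 (suc m) k))

-- Polynomials over ℚ, as lists of coefficients from the constant term upwards
-- (trailing zeros allowed)
module Polynomial where

  Poly : Set
  Poly = List ℚ

  coeff : Poly → ℕ → ℚ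
  coeff []      _       = 0ℚ
  coeff (a ∷ p) zero    = a
  coeff (a ∷ p) (suc i) = coeff p i

  infix  4 _≈_ _≉_
  infixl 6 _+_
  infixl 7 _*_ _·_
  infix  8 -_

  _≈_ _≉_ : Poly → Poly → Set
  p ≈ q = ∀ i → coeff p i ≡ coeff q i
  p ≉ q = ¬ p ≈ q

  _+_ : Poly → Poly → Poly
  []      + q       = q
  (a ∷ p) + []      = a ∷ p
  (a ∷ p) + (b ∷ q) = (a ℚ.+ b) ∷ (p + q)

  -_ : Poly → Poly
  - p = List.map (λ a → ℚ.- a) p

  _·_ : ℚ → Poly → Poly
  a · p = List.map (a ℚ.*_) p

  _*_ : Poly → Poly → Poly
  []      * q = []
  (a ∷ p) * q = a · q + (0ℚ ∷ p * q)

  coeff-+ : ∀ p q i → coeff (p + q) i ≡ coeff p i ℚ.+ coeff q i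
  coeff-+ []      q       i       = sym (ℚ.+-identityˡ _)
  coeff-+ (a ∷ p) []      i       = sym (ℚ.+-identityʳ _)
  coeff-+ (a ∷ p) (b ∷ q) zero    = refl
  coeff-+ (a ∷ p) (b ∷ q) (suc i) = coeff-+ p q i

  coeff-· : ∀ a p i → coeff (a · p) i ≡ a ℚ.* coeff p i
  coeff-· a []      i       = sym (ℚ.*-zeroʳ a)
  coeff-· a (b ∷ p) zero    = refl
  coeff-· a (b ∷ p) (suc i) = coeff-· a p i

  coeff-∷* : ∀ a p q i →
             coeff ((a ∷ p) * q) i ≡ a ℚ.* coeff q i ℚ.+ coeff (0ℚ ∷ p * q) i
  coeff-∷* a p q i =
    trans (coeff-+ (a · q) (0ℚ ∷ p * q) i)
          (cong (ℚ._+ coeff (0ℚ ∷ p * q) i) (coeff-· a q i))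

  *-zeroˡ : ∀ p q → p ≈ [] → p * q ≈ []
  *-zeroˡ []      q p≈0 i = refl
  *-zeroˡ (a ∷ p) q p≈0 i =
    trans (coeff-∷* a p q i)
      (cong₂ ℚ._+_ (trans (cong (ℚ._* coeff q i) (p≈0 0)) (ℚ.*-zeroˡ (coeff q i)))
                   (shifted i))
    where
    shifted : (0ℚ ∷ p * q) ≈ []
    shifted zero    = refl
    shifted (suc i) = *-zeroˡ p q (λ i → p≈0 (suc i)) i

  coeff-*-0 : ∀ p q → coeff (p * q) 0 ≡ coeff p 0 ℚ.* coeff q 0
  coeff-*-0 []      q = sym (ℚ.*-zeroˡ (coeff q 0))
  coeff-*-0 (a ∷ p) q = trans (coeff-∷* a p q 0) (ℚ.+-identityʳ _)

  coeff-*-∷ : ∀ p b q i →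
              coeff (p * (b ∷ q)) (suc i) ≡ coeff p (suc i) ℚ.* b ℚ.+ coeff (p * q) i
  coeff-*-∷ []      b q i       = sym (trans (ℚ.+-identityʳ _) (ℚ.*-zeroˡ b))
  coeff-*-∷ (a ∷ p) b q zero    =
    trans (coeff-∷* a p (b ∷ q) 1)
      (trans (cong (a ℚ.* coeff q 0 ℚ.+_) (coeff-*-0 p (b ∷ q)))
        (trans (ℚ.+-comm (a ℚ.* coeff q 0) (coeff p 0 ℚ.* b))
          (cong (coeff p 0 ℚ.* b ℚ.+_) (sym (coeff-*-0 (a ∷ p) q)))))
  coeff-*-∷ (a ∷ p) b q (suc i) =
    trans (coeff-∷* a p (b ∷ q) (suc (suc i)))
      (trans (cong (a ℚ.* coeff q (suc i) ℚ.+_) (coeff-*-∷ p b q i))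
        (trans (sym (ℚ.+-assoc aq pb pq))
          (trans (cong (ℚ._+ pq) (ℚ.+-comm aq pb))
            (trans (ℚ.+-assoc pb aq pq)
              (cong (pb ℚ.+_) (sym (coeff-∷* a p q (suc i))))))))
    where
    aq = a ℚ.* coeff q (suc i)
    pb = coeff p (suc i) ℚ.* b
    pq = coeff (p * q) i

  ≢0∧*≡0⇒≡0 : ∀ a b → a ≢ 0ℚ → a ℚ.* b ≡ 0ℚ → b ≡ 0ℚ
  ≢0∧*≡0⇒≡0 a b a≢0 ab≡0 =
    trans (sym (ℚ.*-identityˡ b))
      (trans (cong (ℚ._* b) (sym (ℚ.*-inverseˡ a)))
        (trans (ℚ.*-assoc (ℚ.1/ a) a b)
          (trans (cong (ℚ.1/ a ℚ.*_) ab≡0) (ℚ.*-zeroʳ (ℚ.1/ a)))))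
    where instance _ = ℚ.≢-nonZero a≢0

  *-cancel-0 : ∀ p q → p ≉ [] → p * q ≈ [] → q ≈ []
  *-cancel-0 []      q p≉0 pq≈0 i = ⊥-elim (p≉0 λ _ → refl)
  *-cancel-0 (a ∷ p) q p≉0 pq≈0 with a ℚ.≟ 0ℚ
  ... | yes refl = *-cancel-0 p q
          (λ p≈0 → p≉0 λ { zero → refl ; (suc i) → p≈0 i })
          λ i → trans (sym (trans (coeff-∷* 0ℚ p q (suc i))
                  (trans (cong (ℚ._+ coeff (p * q) i) (ℚ.*-zeroˡ (coeff q (suc i))))
                         (ℚ.+-identityˡ _))))
                (pq≈0 (suc i))
  ... | no a≢0 = cancel q pq≈0
    where
    cancel : ∀ q → (a ∷ p) * q ≈ [] → q ≈ []
    cancel []      _    i = refl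
    cancel (b ∷ q) pq≈0 = λ { zero → b≡0 ; (suc i) → cancel q pq′≈0 i }
      where
      b≡0 : b ≡ 0ℚ
      b≡0 = ≢0∧*≡0⇒≡0 a b a≢0 (trans (sym (coeff-*-0 (a ∷ p) (b ∷ q))) (pq≈0 0))
      pq′≈0 : (a ∷ p) * q ≈ []
      pq′≈0 i =
        trans (sym (trans (coeff-*-∷ (a ∷ p) b q i)
          (trans (cong (ℚ._+ coeff ((a ∷ p) * q) i)
                   (trans (cong (coeff (a ∷ p) (suc i) ℚ.*_) b≡0) (ℚ.*-zeroʳ (coeff p i))))
                 (ℚ.+-identityˡ _))))
          (pq≈0 (suc i))

  *-≉0 : ∀ p q → p ≉ [] → q ≉ [] → p * q ≉ []
  *-≉0 p q p≉0 q≉0 pq≈0 = q≉0 (*-cancel-0 p q p≉0 pq≈0)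

module ℚ⟨x⟩ where

  module P = Polynomial

  record Fraction : Set where
    constructor frac
    field
      num   : P.Poly
      den   : P.Poly
      den≉0 : den P.≉ []

  open Fraction public

  1≉0 : (1ℚ ∷ []) P.≉ []
  1≉0 1≈0 with () ← 1≈0 0

  poly : P.Poly → Fraction
  poly p = frac p (1ℚ ∷ []) 1≉0

  rawRing : RawRing 0ℓ 0ℓ
  rawRing = record
    { Carrier = Fraction
    ; _≈_     = λ f g → num f P.* den g P.≈ num g P.* den f
    ; _+_     = λ f g → frac (num f P.* den g P.+ num g P.* den f) (den f P.* den g)
                             (P.*-≉0 (den f) (den g) (den≉0 f) (den≉0 g))
    ; _*_     = λ f g → frac (num f P.* num g) (den f P.* den g)
                             (P.*-≉0 (den f) (den g) (den≉0 f) (den≉0 g))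
    ; -_      = λ f → frac (P.- num f) (den f) (den≉0 f)
    ; 0#      = poly []
    ; 1#      = poly (1ℚ ∷ [])
    }

  open RawRing rawRing public using (_≈_; _+_; _*_; -_; 0#; 1#; rawSemiring)
  open RawSemiringDefs rawSemiring public using (_^_; sum)

  infix  4 _≉_
  infixl 6 _-_

  _≉_ : Fraction → Fraction → Set
  f ≉ g = ¬ f ≈ g

  _-_ : Fraction → Fraction → Fraction
  f - g = f + - g

  inverse : (f : Fraction) → f ≉ 0# → Fraction
  inverse f f≉0 = frac (den f) (num f)
    λ num≈0 → f≉0 (P.*-zeroˡ (num f) (1ℚ ∷ []) num≈0)

  const : ℚ → Fraction
  const a = poly (a ∷ [])

  fromℕ : ℕ → Fraction
  fromℕ N = const (+ N ℚ./ 1)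

  1/_! : ℕ → Fraction
  1/ N ! = const (+ 1 ℚ./ (N !))
    where instance _ = N ℕ.!≢0

  X : Fraction
  X = poly (0ℚ ∷ 1ℚ ∷ [])

  1-X+0≉0 : (1# - X) + 0# ≉ 0#
  1-X+0≉0 1-x≈0 with () ← 1-x≈0 0

  sumOver : {A : Set} → List A → (A → Fraction) → Fraction
  sumOver as f = foldr (λ a s → f a + s) 0# as

-- Power series in t over ℚ(x), as sequences of coefficients
module PowerSeries where

  open ℚ⟨x⟩ using (Fraction; 0#; inverse)
  private module K = ℚ⟨x⟩

  Series : Set
  Series = ℕ → Fraction

  infix  4 _≈_
  infixl 6 _+_
  infixl 7 _*_ _/_⟨_⟩

  _≈_ : Series → Series → Set
  f ≈ g = ∀ n → f n K.≈ g n

  constant : Fraction → Series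
  constant c zero    = c
  constant c (suc _) = 0#

  -- Σ_{n ≥ 1} a_n tⁿ
  Σ≥1 : ((n : ℕ) .{{_ : NonZero n}} → Fraction) → Series
  Σ≥1 a zero    = 0#
  Σ≥1 a (suc m) = a (suc m)

  _+_ : Series → Series → Series
  (f + g) n = f n K.+ g n

  _*_ : Series → Series → Series
  (f * g) n = K.sum {suc n} λ i → f (toℕ i) K.* g (n ∸ toℕ i)

  module _ (g : Series) (g₀≉0 : g 0 K.≉ 0#) where

    -- The coefficients eₙ , … , e₀ of the inverse e of g, determined by
    -- g₀ e₀ = 1 and g₀ eₙ₊₁ = - Σ_{i ≤ n} gᵢ₊₁ eₙ₋ᵢ.
    inverseCoeffs : (n : ℕ) → Vec Fraction (suc n)
    inverseCoeffs zero    = inverse (g 0) g₀≉0 ∷ []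
    inverseCoeffs (suc n) =
      (K.- (inverse (g 0) g₀≉0 K.* K.sum λ i → g (suc (toℕ i)) K.* lookup (inverseCoeffs n) i))
      ∷ inverseCoeffs n

    inverseₛ : Series
    inverseₛ n = Vec.head (inverseCoeffs n)

  _/_⟨_⟩ : Series → (g : Series) → g 0 K.≉ 0# → Series
  f / g ⟨ g₀≉0 ⟩ = f * inverseₛ g g₀≉0

open ℚ⟨x⟩
open PowerSeries using (Series; constant; Σ≥1)

module _ {Υ : Pred (Array 2 k) ℓ} (Υ? : Decidable Υ) where

  D : Series
  D = constant 1# PowerSeries.+ Σ≥1 λ { n@(suc _) →
        1/ (k ℕ.* n) ! * sumOver (𝓕 n k) λ F → X ^ mch Υ? F }

{-# OPTIONS --safe #-}
module Submission where

-- Put y = x - 1, and let A_n be the sum of x^mch(F) over all fillings F with n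
-- columns (A_0 = 1), so that D has the coefficients A_n / (kn)!.  Multiplying by
-- the denominator, comparing coefficients and dividing by y, the theorem says that
--
--   A_(n+1) = Sum_(i ≤ n) binom(k(n+1), k(i+1)) y^i full_(i+1) A_(n-i),
--
-- which is `totalWeight-suc`.  There are two ingredients.
--
-- Pointwise, every array F with at least one column satisfies
--
--   x^mch(F) = Sum_(F = G H, G nonempty) y^(|G| - 1) [G matches everywhere] x^mch(H),
--
-- where |G| is the number of columns of G (`weight-cutSum`).  If the first position
-- is not a match, only the cut after the first column contributes.  If it is one,
-- that cut contributes x^mch(F') for F without its first column F', the other cuts
-- contribute y times the same sum for F', and x = 1 + y.
--
-- Summing over F, a filling with labels in a set S together with a cut into i and j
-- columns is the same as a splitting of S into two sets with a filling of each, of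
-- i and j columns (`sumOver-cutSum-suc`).  Fillings are generated here column by
-- column, by splitting off the labels of the first column, so this becomes the
-- coassociativity of splitting a list into two complementary sublists
-- (`sumOver-splits-assoc`).  Matches depend only on the relative order of the labels,
-- so the sum over the fillings of a set depends only on its size
-- (`sumOver-arrangements-invariant`), and the splittings of an N-set with first part
-- of size p number binom(N, p) (`count-splits`).
--
-- The recurrence is derived in an arbitrary commutative ring with inverses of
-- factorials.  It is applied to ℚ(x), which is shown to be a commutative ring
-- (`FractionField`), and there it determines the coefficients of the quotient
-- (`quotient-unique`).

open import Algebra.Bundles using (CommutativeRing; Semiring)
open import Algebra.Morphism.Structures using (module SemiringMorphisms)
import Algebra.Properties.CommutativeSemigroup as CommSemigroupProperties
import Algebra.Properties.Ring as RingProperties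
import Algebra.Solver.Ring.NaturalCoefficients.Default as SemiringSolver
open import Data.Bool.Base using (Bool; true; false; if_then_else_)
open import Data.Empty using (⊥-elim)
open import Data.Fin.Base as Fin using (Fin; zero; suc; toℕ)
import Data.Fin.Properties as Fin
open import Data.Integer.Base as ℤ using (+_)
import Data.Integer.Properties as ℤ
open import Data.List.Base as List
  using (List; []; _∷_; _++_; map; foldr; length; filter; upTo; tabulate; allFin;
         concatMap; cartesianProductWith)
open import Data.List.Membership.Propositional using (_∈_; find; lose)
open import Data.List.Membership.Propositional.Properties
  using (∈-map⁺; ∈-map⁻; ∈-++⁺ˡ; ∈-++⁺ʳ; ∈-++⁻; ∈-∃++; ∈-concatMap⁺; ∈-concatMap⁻;
         ∈-cartesianProductWith⁺; ∈-cartesianProductWith⁻; ∈-filter⁺; ∈-filter⁻)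
open import Data.List.Membership.Propositional.Properties.WithK using (unique∧set⇒bag)
import Data.List.Properties as List
open import Data.List.Relation.Binary.BagAndSetEquality using (∼bag⇒↭)
open import Data.List.Relation.Binary.Disjoint.Propositional using (Disjoint)
open import Data.List.Relation.Binary.Permutation.Propositional
  using (_↭_; ↭-refl; ↭-sym; ↭-trans; ↭-reflexive; prep)
open import Data.List.Relation.Binary.Permutation.Propositional.Properties
  using (∈-resp-↭; ↭-length; ↭-empty-inv; drop-∷; drop-mid; shift; ++⁺; All-resp-↭)
open import Data.List.Relation.Unary.All as All using (All; []; _∷_)
import Data.List.Relation.Unary.All.Properties as All
open import Data.List.Relation.Unary.AllPairs as AllPairs using (AllPairs; []; _∷_)
import Data.List.Relation.Unary.AllPairs.Properties as AllPairs
open import Data.List.Relation.Unary.Any using (here; there)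
open import Data.List.Relation.Unary.Unique.Propositional using (Unique)
import Data.List.Relation.Unary.Unique.Propositional.Properties as Unique
open import Data.Nat.Base as ℕ using (ℕ; zero; suc; _<_; _≤_; _∸_; _!; z≤n; s≤s; NonZero)
open import Data.Nat.Combinatorics
  using (_C_; nCk+nC[k+1]≡[n+1]C[k+1]; nCk≡n!/k![n-k]!; k![n∸k]!∣n!)
open import Data.Nat.DivMod using (m/n*n≡m)
import Data.Nat.Properties as ℕ
open import Data.Product.Base using (_×_; _,_; proj₁; proj₂; ∃; ∃₂)
open import Data.Rational.Base as ℚ using (ℚ; 0ℚ; 1ℚ)
import Data.Rational.Properties as ℚ
open import Data.Rational.Unnormalised.Base as ℚᵘ using (mkℚᵘ)
import Data.Rational.Unnormalised.Properties as ℚᵘ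
open import Data.Sum.Base using (_⊎_; inj₁; inj₂)
open import Data.Vec.Base as Vec using (Vec; []; _∷_; toList; concat)
import Data.Vec.Properties as Vec
open import Data.Vec.Relation.Unary.All as VAll using ([]; _∷_)
import Data.Vec.Relation.Unary.All.Properties as VAll
open import Data.Vec.Relation.Unary.AllPairs as VAllPairs using ([]; _∷_)
open import Function.Base using (_∘_; id)
open import Function.Bundles using (mk⇔)
open import Level using (Level; 0ℓ)
open import Relation.Binary.Core using (Rel)
open import Relation.Binary.PropositionalEquality
  using (_≡_; _≢_; refl; sym; trans; cong; cong₂; subst; module ≡-Reasoning)
open import Relation.Nullary using (Dec; yes; no; does)
open import Relation.Nullary.Decidable using (dec-false)
open import Relation.Unary using (Pred; Decidable; _⊆_)
open import Defs

private
  variable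
    a b e ℓ : Level
    A : Set a
    B : Set b
    E : Set e

-- The ring of polynomials over ℚ

module PolynomialRing where

  open Polynomial
  open ≡-Reasoning
  private
    module ℚ+ = CommSemigroupProperties
      (CommutativeRing.+-commutativeSemigroup ℚ.+-*-commutativeRing)

  coeff-neg : ∀ p i → coeff (- p) i ≡ ℚ.- coeff p i
  coeff-neg []      i       = refl
  coeff-neg (a ∷ p) zero    = refl
  coeff-neg (a ∷ p) (suc i) = coeff-neg p i

  ≈-sym : ∀ p q → p ≈ q → q ≈ p
  ≈-sym p q p≈q i = sym (p≈q i)

  ≈-trans : ∀ p q r → p ≈ q → q ≈ r → p ≈ r
  ≈-trans p q r p≈q q≈r i = trans (p≈q i) (q≈r i)

  +-cong : ∀ p q r s → p ≈ q → r ≈ s → p + r ≈ q + s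
  +-cong p q r s p≈q r≈s i = begin
    coeff (p + r) i             ≡⟨ coeff-+ p r i ⟩
    coeff p i ℚ.+ coeff r i     ≡⟨ cong₂ ℚ._+_ (p≈q i) (r≈s i) ⟩
    coeff q i ℚ.+ coeff s i     ≡⟨ coeff-+ q s i ⟨
    coeff (q + s) i             ∎

  +-assoc : ∀ p q r → (p + q) + r ≈ p + (q + r)
  +-assoc p q r i = begin
    coeff ((p + q) + r) i                     ≡⟨ coeff-+ (p + q) r i ⟩
    coeff (p + q) i ℚ.+ coeff r i             ≡⟨ cong (ℚ._+ _) (coeff-+ p q i) ⟩
    coeff p i ℚ.+ coeff q i ℚ.+ coeff r i     ≡⟨ ℚ.+-assoc (coeff p i) (coeff q i) (coeff r i) ⟩
    coeff p i ℚ.+ (coeff q i ℚ.+ coeff r i)   ≡⟨ cong (coeff p i ℚ.+_) (coeff-+ q r i) ⟨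
    coeff p i ℚ.+ coeff (q + r) i             ≡⟨ coeff-+ p (q + r) i ⟨
    coeff (p + (q + r)) i                     ∎

  +-comm : ∀ p q → p + q ≈ q + p
  +-comm p q i = begin
    coeff (p + q) i           ≡⟨ coeff-+ p q i ⟩
    coeff p i ℚ.+ coeff q i   ≡⟨ ℚ.+-comm (coeff p i) (coeff q i) ⟩
    coeff q i ℚ.+ coeff p i   ≡⟨ coeff-+ q p i ⟨
    coeff (q + p) i           ∎

  +-identityʳ : ∀ p → p + [] ≈ p
  +-identityʳ []      i = refl
  +-identityʳ (a ∷ p) i = refl

  -‿cong : ∀ p q → p ≈ q → - p ≈ - q
  -‿cong p q p≈q i =
    trans (coeff-neg p i) (trans (cong ℚ.-_ (p≈q i)) (sym (coeff-neg q i)))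

  -‿inverseˡ : ∀ p → - p + p ≈ []
  -‿inverseˡ p i = begin
    coeff (- p + p) i             ≡⟨ coeff-+ (- p) p i ⟩
    coeff (- p) i ℚ.+ coeff p i   ≡⟨ cong (ℚ._+ coeff p i) (coeff-neg p i) ⟩
    ℚ.- coeff p i ℚ.+ coeff p i   ≡⟨ ℚ.+-inverseˡ (coeff p i) ⟩
    0ℚ                            ∎

  -‿inverseʳ : ∀ p → p + - p ≈ []
  -‿inverseʳ p = ≈-trans (p + - p) (- p + p) [] (+-comm p (- p)) (-‿inverseˡ p)

  ∷-cong : ∀ {a b p q} → a ≡ b → p ≈ q → (a ∷ p) ≈ (b ∷ q)
  ∷-cong a≡b p≈q zero    = a≡b
  ∷-cong a≡b p≈q (suc i) = p≈q i

  *-congˡ : ∀ p q r → q ≈ r → p * q ≈ p * r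
  *-congˡ []      q r q≈r i = refl
  *-congˡ (a ∷ p) q r q≈r i = begin
    coeff ((a ∷ p) * q) i                        ≡⟨ coeff-∷* a p q i ⟩
    a ℚ.* coeff q i ℚ.+ coeff (0ℚ ∷ p * q) i
      ≡⟨ cong₂ ℚ._+_ (cong (a ℚ.*_) (q≈r i)) (∷-cong refl (*-congˡ p q r q≈r) i) ⟩
    a ℚ.* coeff r i ℚ.+ coeff (0ℚ ∷ p * r) i     ≡⟨ coeff-∷* a p r i ⟨
    coeff ((a ∷ p) * r) i                        ∎

  *-zeroʳ : ∀ p → p * [] ≈ []
  *-zeroʳ []      i = refl
  *-zeroʳ (a ∷ p) zero    = refl
  *-zeroʳ (a ∷ p) (suc i) = *-zeroʳ p i

  *-comm : ∀ p q → p * q ≈ q * p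
  *-comm []      q i = sym (*-zeroʳ q i)
  *-comm (a ∷ p) q zero = begin
    coeff ((a ∷ p) * q) 0   ≡⟨ coeff-*-0 (a ∷ p) q ⟩
    a ℚ.* coeff q 0         ≡⟨ ℚ.*-comm a (coeff q 0) ⟩
    coeff q 0 ℚ.* a         ≡⟨ coeff-*-0 q (a ∷ p) ⟨
    coeff (q * (a ∷ p)) 0   ∎
  *-comm (a ∷ p) q (suc i) = begin
    coeff ((a ∷ p) * q) (suc i)                   ≡⟨ coeff-∷* a p q (suc i) ⟩
    a ℚ.* coeff q (suc i) ℚ.+ coeff (p * q) i
      ≡⟨ cong₂ ℚ._+_ (ℚ.*-comm a (coeff q (suc i))) (*-comm p q i) ⟩
    coeff q (suc i) ℚ.* a ℚ.+ coeff (q * p) i     ≡⟨ coeff-*-∷ q a p i ⟨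
    coeff (q * (a ∷ p)) (suc i)                   ∎

  *-cong : ∀ p q r s → p ≈ q → r ≈ s → p * r ≈ q * s
  *-cong p q r s p≈q r≈s i = begin
    coeff (p * r) i   ≡⟨ *-congˡ p r s r≈s i ⟩
    coeff (p * s) i   ≡⟨ *-comm p s i ⟩
    coeff (s * p) i   ≡⟨ *-congˡ s p q p≈q i ⟩
    coeff (s * q) i   ≡⟨ *-comm s q i ⟩
    coeff (q * s) i   ∎

  *-distribˡ-+ : ∀ p q r → p * (q + r) ≈ p * q + p * r
  *-distribˡ-+ []      q r i = refl
  *-distribˡ-+ (a ∷ p) q r i = begin
    coeff ((a ∷ p) * (q + r)) i
      ≡⟨ coeff-∷* a p (q + r) i ⟩
    a ℚ.* coeff (q + r) i ℚ.+ coeff (0ℚ ∷ p * (q + r)) i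
      ≡⟨ cong₂ ℚ._+_ (trans (cong (a ℚ.*_) (coeff-+ q r i))
                            (ℚ.*-distribˡ-+ a (coeff q i) (coeff r i)))
                     (trans (∷-cong refl (*-distribˡ-+ p q r) i)
                            (coeff-+ (0ℚ ∷ p * q) (0ℚ ∷ p * r) i)) ⟩
    (a ℚ.* coeff q i ℚ.+ a ℚ.* coeff r i)
      ℚ.+ (coeff (0ℚ ∷ p * q) i ℚ.+ coeff (0ℚ ∷ p * r) i)
      ≡⟨ ℚ+.interchange (a ℚ.* coeff q i) (a ℚ.* coeff r i) _ _ ⟩
    (a ℚ.* coeff q i ℚ.+ coeff (0ℚ ∷ p * q) i)
      ℚ.+ (a ℚ.* coeff r i ℚ.+ coeff (0ℚ ∷ p * r) i)
      ≡⟨ cong₂ ℚ._+_ (coeff-∷* a p q i) (coeff-∷* a p r i) ⟨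
    coeff ((a ∷ p) * q) i ℚ.+ coeff ((a ∷ p) * r) i
      ≡⟨ coeff-+ ((a ∷ p) * q) ((a ∷ p) * r) i ⟨
    coeff ((a ∷ p) * q + (a ∷ p) * r) i ∎

  *-distribʳ-+ : ∀ p q r → (q + r) * p ≈ q * p + r * p
  *-distribʳ-+ p q r i = begin
    coeff ((q + r) * p) i     ≡⟨ *-comm (q + r) p i ⟩
    coeff (p * (q + r)) i     ≡⟨ *-distribˡ-+ p q r i ⟩
    coeff (p * q + p * r) i   ≡⟨ +-cong (p * q) (q * p) (p * r) (r * p) (*-comm p q) (*-comm p r) i ⟩
    coeff (q * p + r * p) i   ∎

  ·-*-assoc : ∀ a p q → (a · p) * q ≈ a · (p * q)
  ·-*-assoc a []      q i = refl
  ·-*-assoc a (b ∷ p) q i = begin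
    coeff ((a ℚ.* b ∷ a · p) * q) i
      ≡⟨ coeff-∷* (a ℚ.* b) (a · p) q i ⟩
    a ℚ.* b ℚ.* coeff q i ℚ.+ coeff (0ℚ ∷ (a · p) * q) i
      ≡⟨ cong₂ ℚ._+_ (ℚ.*-assoc a b (coeff q i)) (shifted i) ⟩
    a ℚ.* (b ℚ.* coeff q i) ℚ.+ a ℚ.* coeff (0ℚ ∷ p * q) i
      ≡⟨ ℚ.*-distribˡ-+ a (b ℚ.* coeff q i) (coeff (0ℚ ∷ p * q) i) ⟨
    a ℚ.* (b ℚ.* coeff q i ℚ.+ coeff (0ℚ ∷ p * q) i)
      ≡⟨ cong (a ℚ.*_) (coeff-∷* b p q i) ⟨
    a ℚ.* coeff ((b ∷ p) * q) i
      ≡⟨ coeff-· a ((b ∷ p) * q) i ⟨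
    coeff (a · ((b ∷ p) * q)) i ∎
    where
    shifted : ∀ i → coeff (0ℚ ∷ (a · p) * q) i ≡ a ℚ.* coeff (0ℚ ∷ p * q) i
    shifted zero    = sym (ℚ.*-zeroʳ a)
    shifted (suc i) = trans (·-*-assoc a p q i) (coeff-· a (p * q) i)

  *-assoc : ∀ p q r → (p * q) * r ≈ p * (q * r)
  *-assoc []      q r i = refl
  *-assoc (a ∷ p) q r i = begin
    coeff ((a · q + (0ℚ ∷ p * q)) * r) i
      ≡⟨ *-distribʳ-+ r (a · q) (0ℚ ∷ p * q) i ⟩
    coeff ((a · q) * r + (0ℚ ∷ p * q) * r) i
      ≡⟨ +-cong ((a · q) * r) (a · (q * r)) ((0ℚ ∷ p * q) * r) (0ℚ ∷ p * (q * r))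
                (·-*-assoc a q r) shifted i ⟩
    coeff (a · (q * r) + (0ℚ ∷ p * (q * r))) i ∎
    where
    shifted : (0ℚ ∷ p * q) * r ≈ (0ℚ ∷ p * (q * r))
    shifted i = begin
      coeff ((0ℚ ∷ p * q) * r) i                          ≡⟨ coeff-∷* 0ℚ (p * q) r i ⟩
      0ℚ ℚ.* coeff r i ℚ.+ coeff (0ℚ ∷ (p * q) * r) i
        ≡⟨ cong₂ ℚ._+_ (ℚ.*-zeroˡ (coeff r i)) (∷-cong refl (*-assoc p q r) i) ⟩
      0ℚ ℚ.+ coeff (0ℚ ∷ p * (q * r)) i                   ≡⟨ ℚ.+-identityˡ _ ⟩
      coeff (0ℚ ∷ p * (q * r)) i                          ∎

  *-identityˡ : ∀ p → (1ℚ ∷ []) * p ≈ p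
  *-identityˡ p i = begin
    coeff ((1ℚ ∷ []) * p) i                        ≡⟨ coeff-∷* 1ℚ [] p i ⟩
    1ℚ ℚ.* coeff p i ℚ.+ coeff (0ℚ ∷ []) i         ≡⟨ cong₂ ℚ._+_ (ℚ.*-identityˡ (coeff p i)) (zeros i) ⟩
    coeff p i ℚ.+ 0ℚ                               ≡⟨ ℚ.+-identityʳ _ ⟩
    coeff p i                                      ∎
    where
    zeros : ∀ i → coeff (0ℚ ∷ []) i ≡ 0ℚ
    zeros zero    = refl
    zeros (suc i) = refl

  *-identityʳ : ∀ p → p * (1ℚ ∷ []) ≈ p
  *-identityʳ p = ≈-trans (p * (1ℚ ∷ [])) ((1ℚ ∷ []) * p) p (*-comm p (1ℚ ∷ [])) (*-identityˡ p)

  commutativeRing : CommutativeRing 0ℓ 0ℓ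
  commutativeRing = record
    { Carrier = Poly ; _≈_ = _≈_ ; _+_ = _+_ ; _*_ = _*_ ; -_ = -_
    ; 0# = [] ; 1# = 1ℚ ∷ []
    ; isCommutativeRing = record
      { isRing = record
        { +-isAbelianGroup = record
          { isGroup = record
            { isMonoid = record
              { isSemigroup = record
                { isMagma = record
                  { isEquivalence = record
                    { refl = λ _ → refl
                    ; sym = λ {p q} → ≈-sym p q
                    ; trans = λ {p q r} → ≈-trans p q r }
                  ; ∙-cong = λ {p q r s} → +-cong p q r s }
                ; assoc = +-assoc }
              ; identity = (λ _ _ → refl) , +-identityʳ }
            ; inverse = -‿inverseˡ , -‿inverseʳ
            ; ⁻¹-cong = λ {p q} → -‿cong p q }
          ; comm = +-comm }
        ; *-cong = λ {p q r s} → *-cong p q r s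
        ; *-assoc = *-assoc
        ; *-identity = *-identityˡ , *-identityʳ
        ; distrib = *-distribˡ-+ , *-distribʳ-+ }
      ; *-comm = *-comm } }

  *-cancelˡ : ∀ p q r → p ≉ [] → p * q ≈ p * r → q ≈ r
  *-cancelˡ p q r p≉0 pq≈pr = x-y≈0⇒x≈y q r (*-cancel-0 p (q + - r) p≉0 p[q-r]≈0)
    where
    open CommutativeRing commutativeRing using (ring; +-group; setoid)
    open RingProperties ring using (-‿distribʳ-*)
    open import Algebra.Properties.Group +-group using (x∙y⁻¹≈ε⇒x≈y)
    x-y≈0⇒x≈y = x∙y⁻¹≈ε⇒x≈y
    p[q-r]≈0 : p * (q + - r) ≈ []
    p[q-r]≈0 i = begin
      coeff (p * (q + - r)) i        ≡⟨ *-distribˡ-+ p q (- r) i ⟩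
      coeff (p * q + p * - r) i      ≡⟨ +-cong (p * q) (p * r) (p * - r) (- (p * r)) pq≈pr
                                          (≈-sym (- (p * r)) (p * - r) (-‿distribʳ-* p r)) i ⟩
      coeff (p * r + - (p * r)) i    ≡⟨ -‿inverseʳ (p * r) i ⟩
      0ℚ                             ∎

-- The field of fractions ℚ(x)

-- The laws of fractions a/b, c/d, e/f after cross-multiplication, in any
-- commutative ring.
module CrossMultiplication {c ℓ} (R : CommutativeRing c ℓ) where

  open CommutativeRing R renaming (refl to ≈-refl) hiding (sym; trans)
  open SemiringSolver commutativeSemiring
  open import Relation.Binary.Reasoning.Setoid setoid

  -- Transitivity up to the factor d, which is cancelled in an integral domain.
  transˣ : ∀ a b c d e f → a * d ≈ c * b → c * f ≈ e * d → d * (a * f) ≈ d * (e * b)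
  transˣ a b c d e f ad≈cb cf≈ed = begin
    d * (a * f)   ≈⟨ solve 3 (λ a d f → d :* (a :* f) := (a :* d) :* f) ≈-refl a d f ⟩
    (a * d) * f   ≈⟨ *-congʳ ad≈cb ⟩
    (c * b) * f   ≈⟨ solve 3 (λ b c f → (c :* b) :* f := (c :* f) :* b) ≈-refl b c f ⟩
    (c * f) * b   ≈⟨ *-congʳ cf≈ed ⟩
    (e * d) * b   ≈⟨ solve 3 (λ b d e → (e :* d) :* b := d :* (e :* b)) ≈-refl b d e ⟩
    d * (e * b)   ∎

  +-congˣ : ∀ a b a′ b′ c d c′ d′ → a * b′ ≈ a′ * b → c * d′ ≈ c′ * d →
            (a * d + c * b) * (b′ * d′) ≈ (a′ * d′ + c′ * b′) * (b * d)
  +-congˣ a b a′ b′ c d c′ d′ p q = begin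
    (a * d + c * b) * (b′ * d′)
      ≈⟨ solve 6 (λ a b b′ c d d′ → (a :* d :+ c :* b) :* (b′ :* d′) :=
           (a :* b′) :* (d :* d′) :+ (c :* d′) :* (b :* b′)) ≈-refl a b b′ c d d′ ⟩
    (a * b′) * (d * d′) + (c * d′) * (b * b′)
      ≈⟨ +-cong (*-congʳ p) (*-congʳ q) ⟩
    (a′ * b) * (d * d′) + (c′ * d) * (b * b′)
      ≈⟨ solve 6 (λ a′ b b′ c′ d d′ → (a′ :* b) :* (d :* d′) :+ (c′ :* d) :* (b :* b′) :=
           (a′ :* d′ :+ c′ :* b′) :* (b :* d)) ≈-refl a′ b b′ c′ d d′ ⟩
    (a′ * d′ + c′ * b′) * (b * d) ∎

  *-congˣ : ∀ a b a′ b′ c d c′ d′ → a * b′ ≈ a′ * b → c * d′ ≈ c′ * d →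
            (a * c) * (b′ * d′) ≈ (a′ * c′) * (b * d)
  *-congˣ a b a′ b′ c d c′ d′ p q = begin
    (a * c) * (b′ * d′)   ≈⟨ interchange a c b′ d′ ⟩
    (a * b′) * (c * d′)   ≈⟨ *-cong p q ⟩
    (a′ * b) * (c′ * d)   ≈⟨ interchange a′ b c′ d ⟩
    (a′ * c′) * (b * d)   ∎
    where open CommSemigroupProperties *-commutativeSemigroup using (interchange)

  +-assocˣ : ∀ a b c d e f →
    ((a * d + c * b) * f + e * (b * d)) * (b * (d * f)) ≈
    (a * (d * f) + (c * f + e * d) * b) * ((b * d) * f)
  +-assocˣ = solve 6 (λ a b c d e f →
    ((a :* d :+ c :* b) :* f :+ e :* (b :* d)) :* (b :* (d :* f)) :=
    (a :* (d :* f) :+ (c :* f :+ e :* d) :* b) :* ((b :* d) :* f)) ≈-refl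

  +-commˣ : ∀ a b c d → (a * d + c * b) * (d * b) ≈ (c * b + a * d) * (b * d)
  +-commˣ = solve 4 (λ a b c d →
    (a :* d :+ c :* b) :* (d :* b) := (c :* b :+ a :* d) :* (b :* d)) ≈-refl

  +-identityˡˣ : ∀ a b → (0# * b + a * 1#) * b ≈ a * (1# * b)
  +-identityˡˣ = solve 2 (λ a b →
    (con 0 :* b :+ a :* con 1) :* b := a :* (con 1 :* b)) ≈-refl

  -‿congˣ : ∀ a b a′ b′ → a * b′ ≈ a′ * b → - a * b′ ≈ - a′ * b
  -‿congˣ a b a′ b′ p = begin
    - a * b′      ≈⟨ -‿distribˡ-* a b′ ⟨
    - (a * b′)    ≈⟨ -‿cong p ⟩
    - (a′ * b)    ≈⟨ -‿distribˡ-* a′ b ⟩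
    - a′ * b      ∎
    where open RingProperties ring using (-‿distribˡ-*)

  -‿inverseˡˣ : ∀ a b → (- a * b + a * b) * 1# ≈ 0# * (b * b)
  -‿inverseˡˣ a b = begin
    (- a * b + a * b) * 1#   ≈⟨ *-congʳ (distribʳ b (- a) a) ⟨
    ((- a + a) * b) * 1#     ≈⟨ *-congʳ (*-congʳ (-‿inverseˡ a)) ⟩
    (0# * b) * 1#            ≈⟨ solve 1 (λ b → (con 0 :* b) :* con 1 := con 0 :* (b :* b)) ≈-refl b ⟩
    0# * (b * b)             ∎

  *-assocˣ : ∀ a b c d e f →
    ((a * c) * e) * (b * (d * f)) ≈ (a * (c * e)) * ((b * d) * f)
  *-assocˣ = solve 6 (λ a b c d e f →
    ((a :* c) :* e) :* (b :* (d :* f)) := (a :* (c :* e)) :* ((b :* d) :* f)) ≈-refl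

  *-commˣ : ∀ a b c d → (a * c) * (d * b) ≈ (c * a) * (b * d)
  *-commˣ = solve 4 (λ a b c d → (a :* c) :* (d :* b) := (c :* a) :* (b :* d)) ≈-refl

  *-identityˡˣ : ∀ a b → (1# * a) * b ≈ a * (1# * b)
  *-identityˡˣ = solve 2 (λ a b → (con 1 :* a) :* b := a :* (con 1 :* b)) ≈-refl

  distribˡˣ : ∀ a b c d e f →
    (a * (c * f + e * d)) * ((b * d) * (b * f)) ≈
    ((a * c) * (b * f) + (a * e) * (b * d)) * (b * (d * f))
  distribˡˣ = solve 6 (λ a b c d e f →
    (a :* (c :* f :+ e :* d)) :* ((b :* d) :* (b :* f)) :=
    ((a :* c) :* (b :* f) :+ (a :* e) :* (b :* d)) :* (b :* (d :* f))) ≈-refl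

module FractionField where

  open ℚ⟨x⟩
  open CrossMultiplication PolynomialRing.commutativeRing
  private module PR = PolynomialRing

  ≈-refl : ∀ {f} → f ≈ f
  ≈-refl i = refl

  ≈-sym : ∀ {f g} → f ≈ g → g ≈ f
  ≈-sym f≈g i = sym (f≈g i)

  ≈-trans : ∀ {f g h} → f ≈ g → g ≈ h → f ≈ h
  ≈-trans {frac a b _} {frac c d d≉0} {frac e f _} p q =
    PR.*-cancelˡ d (a Polynomial.* f) (e Polynomial.* b) d≉0 (transˣ a b c d e f p q)

  +-cong : ∀ {f f′ g g′} → f ≈ f′ → g ≈ g′ → f + g ≈ f′ + g′
  +-cong {frac a b _} {frac a′ b′ _} {frac c d _} {frac c′ d′ _} =
    +-congˣ a b a′ b′ c d c′ d′

  *-cong : ∀ {f f′ g g′} → f ≈ f′ → g ≈ g′ → f * g ≈ f′ * g′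
  *-cong {frac a b _} {frac a′ b′ _} {frac c d _} {frac c′ d′ _} =
    *-congˣ a b a′ b′ c d c′ d′

  -‿cong : ∀ {f f′} → f ≈ f′ → - f ≈ - f′
  -‿cong {frac a b _} {frac a′ b′ _} = -‿congˣ a b a′ b′

  +-assoc : ∀ f g h → (f + g) + h ≈ f + (g + h)
  +-assoc (frac a b _) (frac c d _) (frac e f _) = +-assocˣ a b c d e f

  +-comm : ∀ f g → f + g ≈ g + f
  +-comm (frac a b _) (frac c d _) = +-commˣ a b c d

  +-identityˡ : ∀ f → 0# + f ≈ f
  +-identityˡ (frac a b _) = +-identityˡˣ a b

  -‿inverseˡ : ∀ f → - f + f ≈ 0#
  -‿inverseˡ (frac a b _) = -‿inverseˡˣ a b

  *-assoc : ∀ f g h → (f * g) * h ≈ f * (g * h)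
  *-assoc (frac a b _) (frac c d _) (frac e f _) = *-assocˣ a b c d e f

  *-comm : ∀ f g → f * g ≈ g * f
  *-comm (frac a b _) (frac c d _) = *-commˣ a b c d

  *-identityˡ : ∀ f → 1# * f ≈ f
  *-identityˡ (frac a b _) = *-identityˡˣ a b

  distribˡ : ∀ f g h → f * (g + h) ≈ f * g + f * h
  distribˡ (frac a b _) (frac c d _) (frac e f _) = distribˡˣ a b c d e f

  distribʳ : ∀ f g h → (g + h) * f ≈ g * f + h * f
  distribʳ f g h = ≈-trans {(g + h) * f} {f * (g + h)} {g * f + h * f} (*-comm (g + h) f)
    (≈-trans {f * (g + h)} {f * g + f * h} {g * f + h * f} (distribˡ f g h)
      (+-cong {f * g} {g * f} {f * h} {h * f} (*-comm f g) (*-comm f h)))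

  commutativeRing : CommutativeRing 0ℓ 0ℓ
  commutativeRing = record
    { Carrier = Fraction ; _≈_ = _≈_ ; _+_ = _+_ ; _*_ = _*_ ; -_ = -_
    ; 0# = 0# ; 1# = 1#
    ; isCommutativeRing = record
      { isRing = record
        { +-isAbelianGroup = record
          { isGroup = record
            { isMonoid = record
              { isSemigroup = record
                { isMagma = record
                  { isEquivalence = record
                    { refl = λ {f} → ≈-refl {f}
                    ; sym = λ {f g} → ≈-sym {f} {g}
                    ; trans = λ {f g h} → ≈-trans {f} {g} {h} }
                  ; ∙-cong = λ {f f′ g g′} → +-cong {f} {f′} {g} {g′} }
                ; assoc = +-assoc }
              ; identity = +-identityˡ , λ f →
                  ≈-trans {f + 0#} {0# + f} {f} (+-comm f 0#) (+-identityˡ f) }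
            ; inverse = -‿inverseˡ , λ f →
                ≈-trans {f + - f} { - f + f} {0#} (+-comm f (- f)) (-‿inverseˡ f)
            ; ⁻¹-cong = λ {f g} → -‿cong {f} {g} }
          ; comm = +-comm }
        ; *-cong = λ {f f′ g g′} → *-cong {f} {f′} {g} {g′}
        ; *-assoc = *-assoc
        ; *-identity = *-identityˡ , λ f →
            ≈-trans {f * 1#} {1# * f} {f} (*-comm f 1#) (*-identityˡ f)
        ; distrib = distribˡ , distribʳ }
      ; *-comm = *-comm } }

  inverse-cancelˡ : ∀ f f≉0 → inverse f f≉0 * f ≈ 1#
  inverse-cancelˡ (frac a b _) f≉0 i =
    trans (PR.*-identityʳ (b Polynomial.* a) i)
      (trans (PR.*-comm b a i) (sym (PR.*-identityˡ (a Polynomial.* b) i)))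

-- Naturals and inverse factorials as constants of ℚ(x).
module Constants where

  toℚᵘ-/ : ∀ m d → ℚ.toℚᵘ (+ m ℚ./ suc d) ℚᵘ.≃ mkℚᵘ (+ m) d
  toℚᵘ-/ m d = ℚ.toℚᵘ-fromℚᵘ (mkℚᵘ (+ m) d)

  /1-+ : ∀ m n → + (m ℕ.+ n) ℚ./ 1 ≡ (+ m ℚ./ 1) ℚ.+ (+ n ℚ./ 1)
  /1-+ m n = ℚ.toℚᵘ-injective (begin
    ℚ.toℚᵘ (+ (m ℕ.+ n) ℚ./ 1)                    ≈⟨ toℚᵘ-/ (m ℕ.+ n) 0 ⟩
    mkℚᵘ (+ (m ℕ.+ n)) 0
      ≈⟨ ℚᵘ.*≡* (cong (ℤ._* + 1)
           (cong₂ ℤ._+_ (sym (ℤ.*-identityʳ (+ m))) (sym (ℤ.*-identityʳ (+ n))))) ⟩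
    mkℚᵘ (+ m) 0 ℚᵘ.+ mkℚᵘ (+ n) 0                ≈⟨ ℚᵘ.+-cong (toℚᵘ-/ m 0) (toℚᵘ-/ n 0) ⟨
    ℚ.toℚᵘ (+ m ℚ./ 1) ℚᵘ.+ ℚ.toℚᵘ (+ n ℚ./ 1)    ≈⟨ ℚ.toℚᵘ-homo-+ (+ m ℚ./ 1) (+ n ℚ./ 1) ⟨
    ℚ.toℚᵘ ((+ m ℚ./ 1) ℚ.+ (+ n ℚ./ 1))          ∎)
    where open ℚᵘ.≃-Reasoning

  /1-* : ∀ m n → + (m ℕ.* n) ℚ./ 1 ≡ (+ m ℚ./ 1) ℚ.* (+ n ℚ./ 1)
  /1-* m n = ℚ.toℚᵘ-injective (begin
    ℚ.toℚᵘ (+ (m ℕ.* n) ℚ./ 1)                    ≈⟨ toℚᵘ-/ (m ℕ.* n) 0 ⟩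
    mkℚᵘ (+ (m ℕ.* n)) 0                          ≈⟨ ℚᵘ.*≡* (cong (ℤ._* + 1) (ℤ.pos-* m n)) ⟩
    mkℚᵘ (+ m) 0 ℚᵘ.* mkℚᵘ (+ n) 0                ≈⟨ ℚᵘ.*-cong (toℚᵘ-/ m 0) (toℚᵘ-/ n 0) ⟨
    ℚ.toℚᵘ (+ m ℚ./ 1) ℚᵘ.* ℚ.toℚᵘ (+ n ℚ./ 1)    ≈⟨ ℚ.toℚᵘ-homo-* (+ m ℚ./ 1) (+ n ℚ./ 1) ⟨
    ℚ.toℚᵘ ((+ m ℚ./ 1) ℚ.* (+ n ℚ./ 1))          ∎)
    where open ℚᵘ.≃-Reasoning

  n/1*1/n : ∀ n .{{_ : NonZero n}} → (+ n ℚ./ 1) ℚ.* (+ 1 ℚ./ n) ≡ 1ℚ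
  n/1*1/n n@(suc d) = ℚ.toℚᵘ-injective (begin
    ℚ.toℚᵘ ((+ n ℚ./ 1) ℚ.* (+ 1 ℚ./ n))          ≈⟨ ℚ.toℚᵘ-homo-* (+ n ℚ./ 1) (+ 1 ℚ./ n) ⟩
    ℚ.toℚᵘ (+ n ℚ./ 1) ℚᵘ.* ℚ.toℚᵘ (+ 1 ℚ./ n)    ≈⟨ ℚᵘ.*-cong (toℚᵘ-/ n 0) (toℚᵘ-/ 1 d) ⟩
    mkℚᵘ (+ n) 0 ℚᵘ.* mkℚᵘ (+ 1) d
      ≈⟨ ℚᵘ.*≡* (trans (ℤ.*-identityʳ (+ n ℤ.* + 1)) (trans (ℤ.*-comm (+ n) (+ 1))
           (cong (λ m → + 1 ℤ.* + m) (sym (ℕ.*-identityˡ n))))) ⟩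
    ℚ.toℚᵘ 1ℚ                                     ∎)
    where open ℚᵘ.≃-Reasoning

  open ℚ⟨x⟩

  const-+ : ∀ a b → const (a ℚ.+ b) ≈ const a + const b
  const-+ a b (suc zero)    = refl
  const-+ a b (suc (suc i)) = refl
  const-+ a b zero =
    trans (ℚ.+-identityʳ _) (trans (ℚ.*-identityʳ _) (sym
      (trans (ℚ.+-identityʳ _) (trans (ℚ.*-identityʳ _)
        (cong₂ ℚ._+_ (trans (ℚ.+-identityʳ _) (ℚ.*-identityʳ a))
                     (trans (ℚ.+-identityʳ _) (ℚ.*-identityʳ b)))))))

  const-* : ∀ a b → const (a ℚ.* b) ≈ const a * const b
  const-* a b (suc zero)    = refl
  const-* a b (suc (suc i)) = refl
  const-* a b zero = begin
    a ℚ.* b ℚ.* (1ℚ ℚ.* 1ℚ ℚ.+ 0ℚ) ℚ.+ 0ℚ   ≡⟨⟩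
    a ℚ.* b ℚ.* 1ℚ ℚ.+ 0ℚ                   ≡⟨ cong (λ c → c ℚ.* 1ℚ ℚ.+ 0ℚ) (ℚ.+-identityʳ (a ℚ.* b)) ⟨
    (a ℚ.* b ℚ.+ 0ℚ) ℚ.* 1ℚ ℚ.+ 0ℚ          ∎
    where open ≡-Reasoning

  fromℕ-+ : ∀ m n → fromℕ (m ℕ.+ n) ≈ fromℕ m + fromℕ n
  fromℕ-+ m n rewrite /1-+ m n = const-+ (+ m ℚ./ 1) (+ n ℚ./ 1)

  fromℕ-* : ∀ m n → fromℕ (m ℕ.* n) ≈ fromℕ m * fromℕ n
  fromℕ-* m n rewrite /1-* m n = const-* (+ m ℚ./ 1) (+ n ℚ./ 1)

  n!*1/n! : ∀ n → fromℕ (n !) * 1/ n ! ≈ 1#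
  n!*1/n! n = FractionField.≈-sym {1#} {fromℕ (n !) * 1/ n !}
    (subst (λ q → const q ≈ fromℕ (n !) * 1/ n !) (n/1*1/n (n !))
      (const-* (+ (n !) ℚ./ 1) (+ 1 ℚ./ (n !))))
    where instance _ = n ℕ.!≢0

  fromℕ-isHomomorphism : SemiringMorphisms.IsSemiringHomomorphism ℕ.+-*-rawSemiring
    (Semiring.rawSemiring (CommutativeRing.semiring FractionField.commutativeRing)) fromℕ
  fromℕ-isHomomorphism = record
    { isNearSemiringHomomorphism = record
      { +-isMonoidHomomorphism = record
        { isMagmaHomomorphism = record
          { isRelHomomorphism = record
            { cong = λ { {m} refl → FractionField.≈-refl {fromℕ m} } }
          ; homo = fromℕ-+ }
        ; ε-homo = λ { zero → refl ; (suc i) → refl } }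
      ; *-homo = fromℕ-* }
    ; 1#-homo = FractionField.≈-refl {1#} }

-- Splittings of a list into two complementary sublists

module Fillings where

  open import Data.Nat.Base using (_*_)

  -- Strictly increasing lists represent finite sets of labels.
  Sorted : List ℕ → Set
  Sorted = AllPairs _<_

  Sorted⇒Unique : ∀ {xs} → Sorted xs → Unique xs
  Sorted⇒Unique = AllPairs.map ℕ.<⇒≢

  -- The new entry goes to the first, respectively to the second, part.
  consˡ consʳ : A → List A × List A → List A × List A
  consˡ x (ys , zs) = x ∷ ys , zs
  consʳ x (ys , zs) = ys , x ∷ zs

  -- All pairs of complementary sublists: for a list without repetitions, the ways of
  -- distributing its entries over two sets.  Sublists keep the order, so the parts of
  -- a sorted list are sorted.
  splits : List A → List (List A × List A)
  splits []       = ([] , []) ∷ []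
  splits (x ∷ xs) = map (consˡ x) (splits xs) ++ map (consʳ x) (splits xs)

  splits-∷⁻ : ∀ (x : A) xs {ys zs} → (ys , zs) ∈ splits (x ∷ xs) →
              (∃ λ ys′ → ys ≡ x ∷ ys′ × (ys′ , zs) ∈ splits xs) ⊎
              (∃ λ zs′ → zs ≡ x ∷ zs′ × (ys , zs′) ∈ splits xs)
  splits-∷⁻ x xs p with ∈-++⁻ (map (consˡ x) (splits xs)) p
  ... | inj₁ q with _ , r , refl ← ∈-map⁻ (consˡ x) q = inj₁ (_ , refl , r)
  ... | inj₂ q with _ , r , refl ← ∈-map⁻ (consʳ x) q = inj₂ (_ , refl , r)

  splits-∷ˡ : ∀ (x : A) xs {ys zs} → (ys , zs) ∈ splits xs → (x ∷ ys , zs) ∈ splits (x ∷ xs)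
  splits-∷ˡ x xs p = ∈-++⁺ˡ (∈-map⁺ (consˡ x) p)

  splits-∷ʳ : ∀ (x : A) xs {ys zs} → (ys , zs) ∈ splits xs → (ys , x ∷ zs) ∈ splits (x ∷ xs)
  splits-∷ʳ x xs p = ∈-++⁺ʳ (map (consˡ x) (splits xs)) (∈-map⁺ (consʳ x) p)

  splits-[]ˡ : (xs : List A) → ([] , xs) ∈ splits xs
  splits-[]ˡ []       = here refl
  splits-[]ˡ (x ∷ xs) = splits-∷ʳ x xs (splits-[]ˡ xs)

  splits-↭ : ∀ {xs ys zs : List A} → (ys , zs) ∈ splits xs → ys ++ zs ↭ xs
  splits-↭ {xs = []}     (here refl) = ↭-refl
  splits-↭ {xs = x ∷ xs} p with splits-∷⁻ x xs p
  ... | inj₁ (_ , refl , q) = prep x (splits-↭ q)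
  ... | inj₂ (_ , refl , q) = ↭-trans (shift x _ _) (prep x (splits-↭ q))

  splits-length : ∀ {xs ys zs : List A} → (ys , zs) ∈ splits xs →
                  length ys ℕ.+ length zs ≡ length xs
  splits-length {xs = xs} {ys} p = trans (sym (List.length-++ ys)) (↭-length (splits-↭ {xs = xs} p))

  splits-All : ∀ {P : Pred A ℓ} {xs ys zs} → (ys , zs) ∈ splits xs →
               All P xs → All P ys × All P zs
  splits-All {xs = xs} {ys} p pxs = All.++⁻ ys (All-resp-↭ (↭-sym (splits-↭ {xs = xs} p)) pxs)

  splits-AllPairs : ∀ {R : Rel A ℓ} {xs ys zs} → (ys , zs) ∈ splits xs →
                    AllPairs R xs → AllPairs R ys × AllPairs R zs
  splits-AllPairs {xs = []}     (here refl) [] = [] , []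
  splits-AllPairs {xs = x ∷ xs} p (x~ ∷ rs) with splits-∷⁻ x xs p
  ... | inj₁ (_ , refl , q) = let ys , zs = splits-AllPairs q rs in
                              proj₁ (splits-All q x~) ∷ ys , zs
  ... | inj₂ (_ , refl , q) = let ys , zs = splits-AllPairs q rs in
                              ys , proj₂ (splits-All q x~) ∷ zs

  -- Any sorted ys occurring among the entries of a sorted xs is the first part of
  -- some splitting.
  splits-complete : ∀ {xs ys rs} → Sorted xs → Sorted ys → ys ++ rs ↭ xs →
                    ∃ λ zs → (ys , zs) ∈ splits xs × rs ↭ zs
  splits-complete {xs} {[]} _ _ p = xs , splits-[]ˡ xs , p
  splits-complete {[]} {y ∷ ys} _ _ p with () ← ↭-empty-inv p
  splits-complete {x ∷ xs} {y ∷ ys} {rs} (x< ∷ xs↗) (y< ∷ ys↗) p with y ℕ.≟ x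
  ... | yes refl = let zs , q , r = splits-complete xs↗ ys↗ (drop-∷ p) in
                   zs , splits-∷ˡ x xs q , r
  ... | no y≢x with ∈-++⁻ (y ∷ ys) (∈-resp-↭ (↭-sym p) (here refl))
  -- The minimum x of the sorted list cannot occur in ys, all of whose entries exceed x.
  ...   | inj₁ x∈y∷ys = ⊥-elim (ℕ.<-irrefl refl (All.lookup (x<y ∷ All.map (ℕ.<-trans x<y) y<) x∈y∷ys))
    where
    x<y : x < y
    x<y with ∈-resp-↭ p (here refl)
    ... | here y≡x   = ⊥-elim (y≢x y≡x)
    ... | there y∈xs = All.lookup x< y∈xs
  ...   | inj₂ x∈rs with as , bs , refl ← ∈-∃++ x∈rs =
    let zs , q , r = splits-complete {rs = as ++ bs} xs↗ (y< ∷ ys↗) p′ in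
    x ∷ zs , splits-∷ʳ x xs q , ↭-trans (shift x as bs) (prep x r)
    where
    p′ : (y ∷ ys) ++ as ++ bs ↭ xs
    p′ = ↭-trans (↭-reflexive (sym (List.++-assoc (y ∷ ys) as bs)))
           (drop-mid ((y ∷ ys) ++ as) [] (↭-trans (↭-reflexive (List.++-assoc (y ∷ ys) as (x ∷ bs)))
                                          p))

  -- A splitting of a list without repetitions is determined by its first part.
  splits-distinct : ∀ {xs : List A} → Unique xs →
                    AllPairs (λ p q → proj₁ p ≢ proj₁ q) (splits xs)
  splits-distinct {xs = []} [] = [] ∷ []
  splits-distinct {xs = x ∷ xs} (x∉ ∷ xs!) = AllPairs.++⁺
    (AllPairs.map⁺ (AllPairs.map (_∘ List.∷-injectiveʳ) ih))
    (AllPairs.map⁺ ih)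
    (All.map⁺ (All.universal (λ p → All.map⁺ (All.tabulate (λ q∈ eq →
      All.lookup (proj₁ (splits-All q∈ x∉)) (subst (x ∈_) eq (here refl)) refl))) (splits xs)))
    where ih = splits-distinct xs!

  length-filter-map : ∀ {b p q} {B : Set b} {P : Pred A p} {Q : Pred B q}
    (P? : Decidable P) (Q? : Decidable Q) (f : B → A) →
    (∀ y → does (P? (f y)) ≡ does (Q? y)) →
    ∀ ys → length (filter P? (map f ys)) ≡ length (filter Q? ys)
  length-filter-map P? Q? f eq [] = refl
  length-filter-map P? Q? f eq (y ∷ ys) with does (P? (f y)) | does (Q? y) | eq y
  ... | true  | true  | refl = cong suc (length-filter-map P? Q? f eq ys)
  ... | false | false | refl = length-filter-map P? Q? f eq ys

  length-filter-tabulate : ∀ {p q} {A B : Set} {P : Pred A p} {Q : Pred B q}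
    (P? : Decidable P) (Q? : Decidable Q) {n} (f : Fin n → A) (g : Fin n → B) →
    (∀ i → does (P? (f i)) ≡ does (Q? (g i))) →
    length (filter P? (tabulate f)) ≡ length (filter Q? (tabulate g))
  length-filter-tabulate P? Q? {zero}  f g eq = refl
  length-filter-tabulate P? Q? {suc n} f g eq with does (P? (f zero)) | does (Q? (g zero)) | eq zero
  ... | true  | true  | refl = cong suc (length-filter-tabulate P? Q? (f ∘ suc) (g ∘ suc) (eq ∘ suc))
  ... | false | false | refl = length-filter-tabulate P? Q? (f ∘ suc) (g ∘ suc) (eq ∘ suc)

  -- Whether the first part of a splitting has size p.
  hasSize? : ∀ p → Decidable {A = List A × List A} λ s → length (proj₁ s) ≡ p
  hasSize? p s = length (proj₁ s) ℕ.≟ p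

  count-splits : ∀ p (xs : List A) →
    length (filter (hasSize? p) (splits xs)) ≡ length xs C p
  count-splits zero    [] = refl
  count-splits (suc p) [] = refl
  count-splits p (x ∷ xs) = trans
      (trans (cong length (List.filter-++ (hasSize? p) (map (consˡ x) ss) (map (consʳ x) ss)))
             (List.length-++ (filter (hasSize? p) (map (consˡ x) ss))))
      (trans (cong (length (filter (hasSize? p) (map (consˡ x) ss)) ℕ.+_) (trans
             (length-filter-map (hasSize? p) (hasSize? p) (consʳ x) (λ _ → refl) ss)
                                   (count-splits p xs)))
             (step p))
    where
    ss = splits xs
    step : ∀ p → length (filter (hasSize? p) (map (consˡ x) ss)) ℕ.+ length xs C p ≡ suc (length xs) C p
    step zero = cong (λ l → length l ℕ.+ 1)
      (List.filter-none (hasSize? 0) (All.map⁺ (All.universal (λ _ ()) ss)))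
    step (suc p) = trans
      (cong (ℕ._+ length xs C suc p)
        (trans (length-filter-map (hasSize? (suc p)) (hasSize? p) (consˡ x) (λ _ → refl) ss)
               (count-splits p xs)))
      (nCk+nC[k+1]≡[n+1]C[k+1] (length xs) p)

  -- Fillings with a given set of labels

  -- The list xs as a column of height k; there is none unless xs has length k.
  columns : ∀ k → List A → List (Vec A k)
  columns zero    []       = [] ∷ []
  columns zero    (_ ∷ _)  = []
  columns (suc k) []       = []
  columns (suc k) (x ∷ xs) = map (x ∷_) (columns k xs)

  columns-toList : ∀ k {xs : List A} {c} → c ∈ columns k xs → toList c ≡ xs
  columns-toList zero    {[]}     (here refl) = refl
  columns-toList (suc k) {x ∷ xs} p with _ , q , refl ← ∈-map⁻ (x ∷_) p =
    cong (x ∷_) (columns-toList k q)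

  toList-∈-columns : ∀ {k} (c : Vec A k) → c ∈ columns k (toList c)
  toList-∈-columns []      = here refl
  toList-∈-columns (x ∷ c) = ∈-map⁺ (x ∷_) (toList-∈-columns c)

  columns-Unique : ∀ k (xs : List A) → Unique (columns k xs)
  columns-Unique zero    []       = [] ∷ []
  columns-Unique zero    (_ ∷ _)  = []
  columns-Unique (suc k) []       = []
  columns-Unique (suc k) (x ∷ xs) = Unique.map⁺ Vec.∷-injectiveʳ (columns-Unique k xs)

  -- For sorted xs, the fillings of the k × n array with the entries of xs, generated
  -- by choosing the set ys of labels of the first column and arranging the
  -- remaining labels zs.  There are none unless xs has length k * n.
  arrangements : ∀ n k → List ℕ → List (Array n k)
  arrangements zero    k []       = [] ∷ []
  arrangements zero    k (_ ∷ _)  = []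
  arrangements (suc n) k xs       = concatMap
    (λ (ys , zs) → cartesianProductWith _∷_ (columns k ys) (arrangements n k zs)) (splits xs)

  arrangements-∷⁻ : ∀ {n k} xs {c} {F : Array n k} → c ∷ F ∈ arrangements (suc n) k xs →
    ∃₂ λ ys zs → (ys , zs) ∈ splits xs × c ∈ columns k ys × F ∈ arrangements n k zs
  arrangements-∷⁻ {n} {k} xs p
    with (ys , zs) , s , q ← find (∈-concatMap⁻ (λ (s : List ℕ × List ℕ) →
      cartesianProductWith _∷_ (columns k (proj₁ s)) (arrangements n k (proj₂ s))) {xs = splits xs} p)
    with _ , _ , c∈ , F∈ , refl ← ∈-cartesianProductWith⁻ _∷_ (columns k ys) (arrangements n k zs) q
    = ys , zs , s , c∈ , F∈

  arrangements-∷⁺ : ∀ {n k} xs {ys zs c} {F : Array n k} →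
    (ys , zs) ∈ splits xs → c ∈ columns k ys → F ∈ arrangements n k zs →
    c ∷ F ∈ arrangements (suc n) k xs
  arrangements-∷⁺ xs s c∈ F∈ = ∈-concatMap⁺ _ (lose s (∈-cartesianProductWith⁺ _∷_ c∈ F∈))

  arrangements-entries : ∀ {n k} xs {F : Array n k} → F ∈ arrangements n k xs → entries F ↭ xs
  arrangements-entries [] {[]} p = ↭-refl
  arrangements-entries {suc n} {k} xs {c ∷ F} p
    with ys , zs , s , c∈ , F∈ ← arrangements-∷⁻ xs p =
    ↭-trans (↭-reflexive (Vec.toList-++ c (concat F)))
      (↭-trans (++⁺ (↭-reflexive (columns-toList k c∈)) (arrangements-entries zs F∈))
               (splits-↭ {xs = xs} s))

  toList-AllPairs⁻ : ∀ {k} {R : Rel A ℓ} {c : Vec A k} → AllPairs R (toList c) → VAllPairs.AllPairs R c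
  toList-AllPairs⁻ {c = []}    []         = []
  toList-AllPairs⁻ {c = x ∷ c} (x~ ∷ c~) = VAll.toList⁻ x~ ∷ toList-AllPairs⁻ c~

  toList-AllPairs⁺ : ∀ {k} {R : Rel A ℓ} {c : Vec A k} → VAllPairs.AllPairs R c → AllPairs R (toList c)
  toList-AllPairs⁺ []        = []
  toList-AllPairs⁺ (x~ ∷ c~) = VAll.toList⁺ x~ ∷ toList-AllPairs⁺ c~

  arrangements-increasing : ∀ {n k} xs {F : Array n k} → Sorted xs → F ∈ arrangements n k xs →
    VAll.All (VAllPairs.AllPairs _<_) F
  arrangements-increasing xs {[]} xs↗ p = []
  arrangements-increasing {k = k} xs {c ∷ F} xs↗ p
    with ys , zs , s , c∈ , F∈ ← arrangements-∷⁻ xs p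
    with ys↗ , zs↗ ← splits-AllPairs {xs = xs} s xs↗ =
    toList-AllPairs⁻ (subst Sorted (sym (columns-toList k c∈)) ys↗)
      ∷ arrangements-increasing zs zs↗ F∈

  arrangements-complete : ∀ {n k xs} {F : Array n k} → Sorted xs → entries F ↭ xs →
    VAll.All (VAllPairs.AllPairs _<_) F → F ∈ arrangements n k xs
  arrangements-complete {xs = xs} {[]} xs↗ p [] with refl ← ↭-empty-inv (↭-sym p) = here refl
  arrangements-complete {xs = xs} {c ∷ F} xs↗ p (c↗ ∷ F↗)
    with zs , s , q ← splits-complete xs↗ (toList-AllPairs⁺ c↗)
                        (↭-trans (↭-reflexive (sym (Vec.toList-++ c (concat F)))) p) =
    arrangements-∷⁺ xs s (toList-∈-columns c)
      (arrangements-complete (proj₂ (splits-AllPairs {xs = xs} s xs↗)) q F↗)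

  arrangements-Unique : ∀ n k xs → Sorted xs → Unique (arrangements n k xs)
  arrangements-Unique zero    k []      _ = [] ∷ []
  arrangements-Unique zero    k (_ ∷ _) _ = []
  arrangements-Unique (suc n) k xs xs↗ = Unique.concat⁺
    (All.map⁺ (All.tabulate λ {(ys , zs)} s → Unique.cartesianProductWith⁺ _∷_ Vec.∷-injective
      (columns-Unique k ys) (arrangements-Unique n k zs (proj₂ (splits-AllPairs {xs = xs} s xs↗)))))
    (AllPairs.map⁺ (AllPairs.map disjoint (splits-distinct (Sorted⇒Unique xs↗))))
    where
    disjoint : ∀ {s t} → proj₁ s ≢ proj₁ t → Disjoint
      (cartesianProductWith _∷_ (columns k (proj₁ s)) (arrangements n k (proj₂ s)))
      (cartesianProductWith _∷_ (columns k (proj₁ t)) (arrangements n k (proj₂ t)))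
    disjoint {ys , zs} {ys′ , zs′} ys≢ys′ (p , q)
      with c , _ , c∈ , _ , refl ← ∈-cartesianProductWith⁻ _∷_ (columns k ys) (arrangements n k zs) p
      with _ , _ , c∈′ , _ , refl ← ∈-cartesianProductWith⁻ _∷_ (columns k ys′) (arrangements n k zs′) q
      = ys≢ys′ (trans (sym (columns-toList k c∈)) (columns-toList k c∈′))

  length-entries : ∀ {n k} (F : Array n k) → length (entries F) ≡ k * n
  length-entries {n} {k} F = trans (Vec.length-toList (concat F)) (ℕ.*-comm n k)

  arrangements-empty : ∀ {n k} xs → length xs ≢ k * n → arrangements n k xs ≡ []
  arrangements-empty {n} {k} xs |xs|≢ with arrangements n k xs in eq
  ... | []    = refl
  ... | F ∷ _ = ⊥-elim (|xs|≢ (trans (sym (↭-length (arrangements-entries xs F∈))) (length-entries F)))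
    where F∈ = subst (F ∈_) (sym eq) (here refl)

  vectors-Unique : ∀ {B : Set} {xs : List B} n → Unique xs → Unique (vectors xs n)
  vectors-Unique zero    xs! = [] ∷ []
  vectors-Unique (suc n) xs! =
    Unique.cartesianProductWith⁺ _∷_ Vec.∷-injective xs! (vectors-Unique n xs!)

  ∈-vectors : ∀ {B : Set} {xs : List B} {n} {v : Vec B n} → VAll.All (_∈ xs) v → v ∈ vectors xs n
  ∈-vectors []        = here refl
  ∈-vectors (x∈ ∷ v∈) = ∈-cartesianProductWith⁺ _∷_ x∈ (∈-vectors v∈)

  [1⋯]-Sorted : ∀ N → Sorted [1⋯ N ]
  [1⋯]-Sorted N = AllPairs.map⁺ (AllPairs.map s≤s (AllPairs.applyUpTo⁺₁ id N λ i<j _ → i<j))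

  entries-All⁻ : ∀ {n k} {P : Pred ℕ ℓ} (F : Array n k) → All P (entries F) → VAll.All (VAll.All P) F
  entries-All⁻ []      _  = []
  entries-All⁻ {P = P} (c ∷ F) ps
    with pc , pF ← All.++⁻ (toList c) (subst (All P) (Vec.toList-++ c (concat F)) ps) =
    VAll.toList⁻ pc ∷ entries-All⁻ F pF

  𝓕-↭-arrangements : ∀ n k → 𝓕 n k ↭ arrangements n k [1⋯ k * n ]
  𝓕-↭-arrangements n k = ∼bag⇒↭ (unique∧set⇒bag
    (Unique.filter⁺ isFilling? (vectors-Unique n (vectors-Unique k (Sorted⇒Unique sorted))))
    (arrangements-Unique n k _ sorted)
    (mk⇔ to from))
    where
    sorted = [1⋯]-Sorted (k * n)
    to : ∀ {F} → F ∈ 𝓕 n k → F ∈ arrangements n k [1⋯ k * n ]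
    to F∈ with p , F↗ ← proj₂ (∈-filter⁻ isFilling? {xs = vectors (vectors [1⋯ k * n ] k) n} F∈) =
      arrangements-complete sorted p F↗
    from : ∀ {F} → F ∈ arrangements n k [1⋯ k * n ] → F ∈ 𝓕 n k
    from {F} F∈ = ∈-filter⁺ isFilling?
        (∈-vectors (VAll.map ∈-vectors (entries-All⁻ F (All.tabulate (∈-resp-↭ p)))))
        (p , arrangements-increasing _ sorted F∈)
      where p = arrangements-entries _ F∈

  -- Order-preserving relabelling

  StrictMono : (ℕ → ℕ) → Set
  StrictMono ρ = ∀ {i j} → i < j → ρ i < ρ j

  -- Replaces every entry a by ρ a.
  relabel : ∀ {n k} → (ℕ → ℕ) → Array n k → Array n k
  relabel ρ = Vec.map (Vec.map ρ)

  StrictMono-cancel-≤ : ∀ {ρ} → StrictMono ρ → ∀ {i j} → ρ i ≤ ρ j → i ≤ j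
  StrictMono-cancel-≤ mono ρi≤ρj = ℕ.≮⇒≥ λ j<i → ℕ.<⇒≱ (mono j<i) ρi≤ρj

  StrictMono-≤ : ∀ {ρ} → StrictMono ρ → ∀ {i j} → i ≤ j → ρ i ≤ ρ j
  StrictMono-≤ mono i≤j with ℕ.m≤n⇒m<n∨m≡n i≤j
  ... | inj₁ i<j  = ℕ.<⇒≤ (mono i<j)
  ... | inj₂ refl = ℕ.≤-refl

  entries-relabel : ∀ {n k} ρ (F : Array n k) → entries (relabel ρ F) ≡ map ρ (entries F)
  entries-relabel ρ F = trans (cong toList (sym (Vec.map-concat ρ F))) (Vec.toList-map ρ (concat F))

  does-≡ : ∀ {p q} {P : Set p} {Q : Set q} (P? : Dec P) (Q? : Dec Q) →
           (P → Q) → (Q → P) → does P? ≡ does Q?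
  does-≡ (yes p) (yes q) f g = refl
  does-≡ (yes p) (no ¬q) f g = ⊥-elim (¬q (f p))
  does-≡ (no ¬p) (yes q) f g = ⊥-elim (¬p (g q))
  does-≡ (no ¬p) (no ¬q) f g = refl

  red-relabel : ∀ {n k ρ} → StrictMono ρ → (F : Array n k) → red (relabel ρ F) ≡ red F
  red-relabel {ρ = ρ} mono F = trans (sym (Vec.map-∘ _ _ F)) (Vec.map-cong
    (λ c → trans (sym (Vec.map-∘ _ ρ c)) (Vec.map-cong rank c)) F)
    where
    rank : ∀ a → length (filter (ℕ._≤? ρ a) (entries (relabel ρ F))) ≡
                 length (filter (ℕ._≤? a) (entries F))
    rank a = trans (cong (λ xs → length (filter (ℕ._≤? ρ a) xs)) (entries-relabel ρ F))
      (length-filter-map (ℕ._≤? ρ a) (ℕ._≤? a) ρ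
        (λ b → does-≡ (ρ b ℕ.≤? ρ a) (b ℕ.≤? a)
          (StrictMono-cancel-≤ mono) (StrictMono-≤ mono))
        (entries F))

  -- Every sorted list of length N is an order-preserving relabelling of 0, …, N - 1.
  -- The relabelling is defined on all of ℕ; the lower bound b makes room for a
  -- smaller first entry in the induction.
  Sorted⇒relabelled : ∀ b {xs} → All (b ≤_) xs → Sorted xs →
    ∃ λ ρ → StrictMono ρ × b ≤ ρ 0 × map ρ (upTo (length xs)) ≡ xs
  Sorted⇒relabelled b [] [] = (b ℕ.+_) , ℕ.+-monoʳ-< b , ℕ.m≤m+n b 0 , refl
  Sorted⇒relabelled b {x ∷ xs} (b≤x ∷ _) (x< ∷ xs↗)
    with ρ , mono , x<ρ0 , eq ← Sorted⇒relabelled (suc x) x< xs↗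
    = ρ′ , mono′ , b≤x , cong (x ∷_)
        (trans (cong (map ρ′) (sym (List.map-upTo suc (length xs)))) (trans (sym (List.map-∘ _)) eq))
    where
    ρ′ : ℕ → ℕ
    ρ′ zero    = x
    ρ′ (suc i) = ρ i
    mono′ : StrictMono ρ′
    mono′ {zero}  {suc j} _         = ℕ.<-≤-trans x<ρ0 (StrictMono-≤ mono z≤n)
    mono′ {suc i} {suc j} (s≤s i<j) = mono i<j

  -- Binomial coefficients as quotients of factorials

  [m+n]Cm*m!*n!≡[m+n]! : ∀ m n → ((m ℕ.+ n) C m) * (m ! * n !) ≡ (m ℕ.+ n) !
  [m+n]Cm*m!*n!≡[m+n]! m n = trans
    (cong (λ j → ((m ℕ.+ n) C m) * (m ! * j !)) (sym (ℕ.m+n∸m≡n m n)))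
    (trans (cong (_* (m ! * (m ℕ.+ n ∸ m) !)) (nCk≡n!/k![n-k]! m≤m+n))
           (m/n*n≡m (k![n∸k]!∣n! m≤m+n)))
    where
    m≤m+n = ℕ.m≤m+n m n
    instance _ = m ℕ.!* (m ℕ.+ n ∸ m) !≢0

open Fillings

-- Matches column by column

module Matches {k ℓ} {Υ : Pred (Array 2 k) ℓ} (Υ? : Decidable Υ) where

  -- Whether two adjacent columns form a match.
  match : Vec ℕ k → Vec ℕ k → Bool
  match c d = does (Υ? (red (c ∷ d ∷ [])))

  mch-∷ : ∀ {m} c d (F : Array m k) →
    mch Υ? (c ∷ d ∷ F) ≡ (if match c d then suc (mch Υ? (d ∷ F)) else mch Υ? (d ∷ F))
  mch-∷ c d F with match c d
  ... | true  = cong suc laterMatches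
    where laterMatches = length-filter-tabulate
            (match? Υ? (c ∷ d ∷ F)) (match? Υ? (d ∷ F)) suc id λ _ → refl
  ... | false = length-filter-tabulate
            (match? Υ? (c ∷ d ∷ F)) (match? Υ? (d ∷ F)) suc id λ _ → refl

  mch-≤ : ∀ {m} (F : Array (suc m) k) → mch Υ? F ≤ m
  mch-≤ {m} F = subst (mch Υ? F ≤_) (List.length-tabulate id)
    (List.length-filter (match? Υ? F) (allFin m))

  mch-relabel : ∀ {m ρ} → StrictMono ρ → (F : Array (suc m) k) → mch Υ? (relabel ρ F) ≡ mch Υ? F
  mch-relabel mono (c ∷ []) = refl
  mch-relabel {ρ = ρ} mono (c ∷ d ∷ F)
    rewrite mch-∷ (Vec.map ρ c) (Vec.map ρ d) (relabel ρ F) | mch-∷ c d F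
          | red-relabel mono (c ∷ d ∷ []) | mch-relabel mono (d ∷ F) = refl

-- Sums over splittings, fillings and cuts

module FiniteSums {r ℓr} (R : CommutativeRing r ℓr) where

  open CommutativeRing R hiding (zero) renaming (refl to ≈-refl; sym to ≈-sym; trans to ≈-trans; _*_ to _·_)
  open import Relation.Binary.Reasoning.Setoid setoid
  open import Algebra.Properties.CommutativeMonoid.Sum +-commutativeMonoid
    using (sum; sum-cong-≋; ∑-distrib-+; sum-replicate-zero)
  open CommSemigroupProperties +-commutativeSemigroup using (interchange)

  sumOver : List A → (A → Carrier) → Carrier
  sumOver xs f = foldr (λ x s → f x + s) 0# xs

  sumOver-cong-∈ : ∀ {f g : A → Carrier} xs → (∀ {x} → x ∈ xs → f x ≈ g x) →
                   sumOver xs f ≈ sumOver xs g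
  sumOver-cong-∈ []       f≈g = ≈-refl
  sumOver-cong-∈ (x ∷ xs) f≈g = +-cong (f≈g (here refl)) (sumOver-cong-∈ xs (f≈g ∘ there))

  sumOver-cong : ∀ {f g : A → Carrier} xs → (∀ x → f x ≈ g x) → sumOver xs f ≈ sumOver xs g
  sumOver-cong xs f≈g = sumOver-cong-∈ xs λ {x} _ → f≈g x

  sumOver-++ : ∀ (f : A → Carrier) xs ys →
               sumOver (xs ++ ys) f ≈ sumOver xs f + sumOver ys f
  sumOver-++ f []       ys = ≈-sym (+-identityˡ _)
  sumOver-++ f (x ∷ xs) ys = ≈-trans (+-congˡ (sumOver-++ f xs ys)) (≈-sym (+-assoc _ _ _))

  sumOver-map : ∀ (f : B → Carrier) (h : A → B) xs → sumOver (map h xs) f ≈ sumOver xs (f ∘ h)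
  sumOver-map f h []       = ≈-refl
  sumOver-map f h (x ∷ xs) = +-congˡ (sumOver-map f h xs)

  sumOver-concatMap : ∀ (f : B → Carrier) (h : A → List B) xs →
                      sumOver (concatMap h xs) f ≈ sumOver xs λ x → sumOver (h x) f
  sumOver-concatMap f h []       = ≈-refl
  sumOver-concatMap f h (x ∷ xs) =
    ≈-trans (sumOver-++ f (h x) (concatMap h xs)) (+-congˡ (sumOver-concatMap f h xs))

  sumOver-cartesianProductWith : ∀ (f : E → Carrier) (h : A → B → E) xs ys →
    sumOver (cartesianProductWith h xs ys) f ≈ sumOver xs λ x → sumOver ys λ y → f (h x y)
  sumOver-cartesianProductWith f h []       ys = ≈-refl
  sumOver-cartesianProductWith f h (x ∷ xs) ys =
    ≈-trans (sumOver-++ f (map (h x) ys) (cartesianProductWith h xs ys))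
      (+-cong (sumOver-map f (h x) ys) (sumOver-cartesianProductWith f h xs ys))

  sumOver-↭ : ∀ (f : A → Carrier) {xs ys} → xs ↭ ys → sumOver xs f ≈ sumOver ys f
  sumOver-↭ f _↭_.refl          = ≈-refl
  sumOver-↭ f (_↭_.prep x p)    = +-congˡ (sumOver-↭ f p)
  sumOver-↭ f {xs = _ ∷ _ ∷ xs} {_ ∷ _ ∷ ys} (_↭_.swap x y p) = begin
    f x + (f y + sumOver xs f)   ≈⟨ +-assoc _ _ _ ⟨
    f x + f y + sumOver xs f     ≈⟨ +-cong (+-comm _ _) (sumOver-↭ f p) ⟩
    f y + f x + sumOver ys f     ≈⟨ +-assoc _ _ _ ⟩
    f y + (f x + sumOver ys f)   ∎
  sumOver-↭ f (_↭_.trans p q)   = ≈-trans (sumOver-↭ f p) (sumOver-↭ f q)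

  sumOver-zero : (xs : List A) → sumOver xs (λ _ → 0#) ≈ 0#
  sumOver-zero []       = ≈-refl
  sumOver-zero (x ∷ xs) = ≈-trans (+-identityˡ _) (sumOver-zero xs)

  sumOver-+ : ∀ (f g : A → Carrier) xs →
              sumOver xs (λ x → f x + g x) ≈ sumOver xs f + sumOver xs g
  sumOver-+ f g []       = ≈-sym (+-identityˡ 0#)
  sumOver-+ f g (x ∷ xs) = ≈-trans (+-congˡ (sumOver-+ f g xs)) (interchange _ _ _ _)

  *-distribˡ-sumOver : ∀ c (f : A → Carrier) xs → c · sumOver xs f ≈ sumOver xs λ x → c · f x
  *-distribˡ-sumOver c f []       = zeroʳ c
  *-distribˡ-sumOver c f (x ∷ xs) = ≈-trans (distribˡ c _ _) (+-congˡ (*-distribˡ-sumOver c f xs))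

  *-distribʳ-sumOver : ∀ c (f : A → Carrier) xs → sumOver xs f · c ≈ sumOver xs λ x → f x · c
  *-distribʳ-sumOver c f []       = zeroˡ c
  *-distribʳ-sumOver c f (x ∷ xs) = ≈-trans (distribʳ c _ _) (+-congˡ (*-distribʳ-sumOver c f xs))

  sumOver-comm : ∀ (f : A → B → Carrier) xs ys →
    sumOver xs (λ x → sumOver ys λ y → f x y) ≈ sumOver ys λ y → sumOver xs λ x → f x y
  sumOver-comm f []       ys = ≈-sym (sumOver-zero ys)
  sumOver-comm f (x ∷ xs) ys =
    ≈-trans (+-congˡ (sumOver-comm f xs ys)) (≈-sym (sumOver-+ (f x) _ ys))

  sumOver-sum-comm : ∀ {n} (f : A → Fin n → Carrier) xs →
    sumOver xs (λ x → sum (f x)) ≈ sum λ i → sumOver xs λ x → f x i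
  sumOver-sum-comm {n = n} f []       = ≈-sym (sum-replicate-zero n)
  sumOver-sum-comm f (x ∷ xs) =
    ≈-trans (+-congˡ (sumOver-sum-comm f xs)) (≈-sym (∑-distrib-+ (f x) _))

  sumOver-splits-∷ : ∀ (f : List A × List A → Carrier) x xs →
    sumOver (splits (x ∷ xs)) f ≈
    sumOver (splits xs) (f ∘ consˡ x) + sumOver (splits xs) (f ∘ consʳ x)
  sumOver-splits-∷ f x xs = ≈-trans (sumOver-++ f (map (consˡ x) (splits xs)) _)
    (+-cong (sumOver-map f (consˡ x) (splits xs)) (sumOver-map f (consʳ x) (splits xs)))

  -- Both sides are the sum over all ways of distributing xs over three parts.
  sumOver-splits-assoc : ∀ (f : List A → List A → List A → Carrier) xs →
    sumOver (splits xs) (λ (as , bs) → sumOver (splits bs) λ (cs , ds) → f as cs ds) ≈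
    sumOver (splits xs) (λ (es , ds) → sumOver (splits es) λ (as , cs) → f as cs ds)
  sumOver-splits-assoc f []       = ≈-refl
  sumOver-splits-assoc f (x ∷ xs) = begin
    sumOver (splits (x ∷ xs)) (λ (as , bs) → sumOver (splits bs) λ (cs , ds) → f as cs ds)
      ≈⟨ sumOver-splits-∷ _ x xs ⟩
    sumOver (splits xs) (λ (as , bs) → sumOver (splits bs) λ (cs , ds) → f (x ∷ as) cs ds) +
    sumOver (splits xs) (λ (as , bs) → sumOver (splits (x ∷ bs)) λ (cs , ds) → f as cs ds)
      ≈⟨ +-congˡ (≈-trans (sumOver-cong (splits xs) λ (as , bs) → sumOver-splits-∷ _ x bs)
                          (sumOver-+ _ _ (splits xs))) ⟩
    sumOver (splits xs) (λ (as , bs) → sumOver (splits bs) λ (cs , ds) → f (x ∷ as) cs ds) +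
    (sumOver (splits xs) (λ (as , bs) → sumOver (splits bs) λ (cs , ds) → f as (x ∷ cs) ds) +
     sumOver (splits xs) (λ (as , bs) → sumOver (splits bs) λ (cs , ds) → f as cs (x ∷ ds)))
      ≈⟨ +-cong (sumOver-splits-assoc (λ as → f (x ∷ as)) xs)
                (+-cong (sumOver-splits-assoc (λ as cs → f as (x ∷ cs)) xs)
                        (sumOver-splits-assoc (λ as cs ds → f as cs (x ∷ ds)) xs)) ⟩
    sumOver (splits xs) (λ (es , ds) → sumOver (splits es) λ (as , cs) → f (x ∷ as) cs ds) +
    (sumOver (splits xs) (λ (es , ds) → sumOver (splits es) λ (as , cs) → f as (x ∷ cs) ds) +
     sumOver (splits xs) (λ (es , ds) → sumOver (splits es) λ (as , cs) → f as cs (x ∷ ds)))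
      ≈⟨ +-assoc _ _ _ ⟨
    sumOver (splits xs) (λ (es , ds) → sumOver (splits es) λ (as , cs) → f (x ∷ as) cs ds) +
    sumOver (splits xs) (λ (es , ds) → sumOver (splits es) λ (as , cs) → f as (x ∷ cs) ds) +
    sumOver (splits xs) (λ (es , ds) → sumOver (splits es) λ (as , cs) → f as cs (x ∷ ds))
      ≈⟨ +-congʳ (≈-trans (sumOver-cong (splits xs) λ (es , ds) → sumOver-splits-∷ _ x es)
                          (sumOver-+ _ _ (splits xs))) ⟨
    sumOver (splits xs) (λ (es , ds) → sumOver (splits (x ∷ es)) λ (as , cs) → f as cs ds) +
    sumOver (splits xs) (λ (es , ds) → sumOver (splits es) λ (as , cs) → f as cs (x ∷ ds))
      ≈⟨ sumOver-splits-∷ _ x xs ⟨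
    sumOver (splits (x ∷ xs)) (λ (es , ds) → sumOver (splits es) λ (as , cs) → f as cs ds) ∎

  sumOver-splits-map : ∀ (f : List B × List B → Carrier) (h : A → B) xs →
    sumOver (splits (map h xs)) f ≈ sumOver (splits xs) λ (ys , zs) → f (map h ys , map h zs)
  sumOver-splits-map f h []       = ≈-refl
  sumOver-splits-map f h (x ∷ xs) = begin
    sumOver (splits (map h (x ∷ xs))) f
      ≈⟨ sumOver-splits-∷ f (h x) (map h xs) ⟩
    sumOver (splits (map h xs)) (f ∘ consˡ (h x)) + sumOver (splits (map h xs)) (f ∘ consʳ (h x))
      ≈⟨ +-cong (sumOver-splits-map _ h xs) (sumOver-splits-map _ h xs) ⟩
    _
      ≈⟨ sumOver-splits-∷ (λ (ys , zs) → f (map h ys , map h zs)) x xs ⟨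
    sumOver (splits (x ∷ xs)) (λ (ys , zs) → f (map h ys , map h zs)) ∎

  module _ {k : ℕ} where

    -- An array with no columns has no labels, so only the splitting with empty
    -- first part contributes.
    sumOver-splits-identityˡ : ∀ (f : Array 0 k → List ℕ → Carrier) xs →
      sumOver (splits xs) (λ (ys , zs) → sumOver (arrangements 0 k ys) λ F → f F zs) ≈ f [] xs
    sumOver-splits-identityˡ f []       = ≈-trans (+-identityʳ _) (+-identityʳ _)
    sumOver-splits-identityˡ f (x ∷ xs) = begin
      sumOver (splits (x ∷ xs)) (λ (ys , zs) → sumOver (arrangements 0 k ys) λ F → f F zs)
        ≈⟨ sumOver-splits-∷ _ x xs ⟩
      sumOver (splits xs) (λ _ → 0#) +
      sumOver (splits xs) (λ (ys , zs) → sumOver (arrangements 0 k ys) λ F → f F (x ∷ zs))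
        ≈⟨ +-cong (sumOver-zero (splits xs)) (sumOver-splits-identityˡ (λ F → f F ∘ (x ∷_)) xs) ⟩
      0# + f [] (x ∷ xs)   ≈⟨ +-identityˡ _ ⟩
      f [] (x ∷ xs)        ∎

    sumOver-splits-identityʳ : ∀ (f : List ℕ → Array 0 k → Carrier) xs →
      sumOver (splits xs) (λ (ys , zs) → sumOver (arrangements 0 k zs) λ F → f ys F) ≈ f xs []
    sumOver-splits-identityʳ f []       = ≈-trans (+-identityʳ _) (+-identityʳ _)
    sumOver-splits-identityʳ f (x ∷ xs) = begin
      sumOver (splits (x ∷ xs)) (λ (ys , zs) → sumOver (arrangements 0 k zs) λ F → f ys F)
        ≈⟨ sumOver-splits-∷ _ x xs ⟩
      sumOver (splits xs) (λ (ys , zs) → sumOver (arrangements 0 k zs) λ F → f (x ∷ ys) F) +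
      sumOver (splits xs) (λ _ → 0#)
        ≈⟨ +-cong (sumOver-splits-identityʳ (f ∘ (x ∷_)) xs) (sumOver-zero (splits xs)) ⟩
      f (x ∷ xs) [] + 0#   ≈⟨ +-identityʳ _ ⟩
      f (x ∷ xs) []        ∎

    sumOver-arrangements-suc : ∀ {n} (f : Array (suc n) k → Carrier) xs →
      sumOver (arrangements (suc n) k xs) f ≈
      sumOver (splits xs) λ (ys , zs) → sumOver (columns k ys) λ c →
        sumOver (arrangements n k zs) λ F → f (c ∷ F)
    sumOver-arrangements-suc {n} f xs = ≈-trans (sumOver-concatMap f _ (splits xs))
      (sumOver-cong (splits xs) λ (ys , zs) →
        sumOver-cartesianProductWith f _∷_ (columns k ys) (arrangements n k zs))

    sumOver-columns-map : ∀ k {h : A → B} (f : Vec B k → Carrier) xs →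
      sumOver (columns k (map h xs)) f ≈ sumOver (columns k xs) (f ∘ Vec.map h)
    sumOver-columns-map zero    f []       = ≈-refl
    sumOver-columns-map zero    f (x ∷ xs) = ≈-refl
    sumOver-columns-map (suc k) f []       = ≈-refl
    sumOver-columns-map (suc k) {h} f (x ∷ xs) = begin
      sumOver (map (h x ∷_) (columns k (map h xs))) f    ≈⟨ sumOver-map f (h x ∷_) (columns k (map h xs)) ⟩
      sumOver (columns k (map h xs)) (f ∘ (h x ∷_))      ≈⟨ sumOver-columns-map k (f ∘ (h x ∷_)) xs ⟩
      sumOver (columns k xs) (f ∘ (h x ∷_) ∘ Vec.map h)  ≈⟨ sumOver-map (f ∘ Vec.map h) (x ∷_) (columns k xs) ⟨
      sumOver (columns (suc k) (x ∷ xs)) (f ∘ Vec.map h) ∎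

    sumOver-arrangements-map : ∀ {n} ρ (f : Array n k → Carrier) xs →
      sumOver (arrangements n k (map ρ xs)) f ≈ sumOver (arrangements n k xs) (f ∘ relabel ρ)
    sumOver-arrangements-map {zero}  ρ f []       = ≈-refl
    sumOver-arrangements-map {zero}  ρ f (x ∷ xs) = ≈-refl
    sumOver-arrangements-map {suc n} ρ f xs = begin
      sumOver (arrangements (suc n) k (map ρ xs)) f
        ≈⟨ sumOver-arrangements-suc f (map ρ xs) ⟩
      (sumOver (splits (map ρ xs)) λ (ys , zs) → sumOver (columns k ys) λ c →
        sumOver (arrangements n k zs) λ F → f (c ∷ F))
        ≈⟨ sumOver-splits-map _ ρ xs ⟩
      (sumOver (splits xs) λ (ys , zs) → sumOver (columns k (map ρ ys)) λ c →
        sumOver (arrangements n k (map ρ zs)) λ F → f (c ∷ F))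
        ≈⟨ sumOver-cong (splits xs) (λ (ys , zs) → ≈-trans (sumOver-columns-map k _ ys)
             (sumOver-cong (columns k ys) λ c → sumOver-arrangements-map {n} ρ _ zs)) ⟩
      (sumOver (splits xs) λ (ys , zs) → sumOver (columns k ys) λ c →
        sumOver (arrangements n k zs) λ F → f (relabel ρ (c ∷ F)))
        ≈⟨ sumOver-arrangements-suc (f ∘ relabel ρ) xs ⟨
      sumOver (arrangements (suc n) k xs) (f ∘ relabel ρ) ∎

    -- A function of arrays that depends only on the relative order of the entries.
    Invariant : ∀ {n} → (Array n k → Carrier) → Set ℓr
    Invariant f = ∀ {ρ} → StrictMono ρ → ∀ F → f (relabel ρ F) ≈ f F

    -- The sum of an invariant function over the fillings with given labels depends
    -- only on the number of labels: both label sets are relabellings of 0, …, N - 1.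
    sumOver-arrangements-invariant : ∀ {n} (f : Array n k → Carrier) → Invariant f →
      ∀ {xs} → Sorted xs →
      sumOver (arrangements n k xs) f ≈ sumOver (arrangements n k [1⋯ length xs ]) f
    sumOver-arrangements-invariant {n} f inv {xs} xs↗
      with ρ , mono , _ , eq ← Sorted⇒relabelled 0 (All.universal (λ _ → z≤n) xs) xs↗ = begin
      sumOver (arrangements n k xs) f
        ≡⟨ cong (λ zs → sumOver (arrangements n k zs) f) (sym eq) ⟩
      sumOver (arrangements n k (map ρ is)) f
        ≈⟨ sumOver-arrangements-map ρ f is ⟩
      sumOver (arrangements n k is) (f ∘ relabel ρ)
        ≈⟨ sumOver-cong (arrangements n k is) (λ F → ≈-trans (inv mono F) (≈-sym (inv s≤s F))) ⟩
      sumOver (arrangements n k is) (f ∘ relabel suc)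
        ≈⟨ sumOver-arrangements-map suc f is ⟨
      sumOver (arrangements n k (map suc is)) f ∎
      where is = upTo (length xs)

    -- The sum of f G H over all ways to cut an array into a left part G and a right
    -- part H, either of which may have no columns.
    cutSum : ∀ {n} → (∀ {i j} → Array i k → Array j k → Carrier) → Array n k → Carrier
    cutSum f []      = f [] []
    cutSum f (c ∷ F) = f [] (c ∷ F) + cutSum (λ G H → f (c ∷ G) H) F

    cutSum-cong : ∀ {f g : ∀ {i j} → Array i k → Array j k → Carrier} →
      (∀ {i j} (G : Array i k) (H : Array j k) → f G H ≈ g G H) →
      ∀ {n} (F : Array n k) → cutSum f F ≈ cutSum g F
    cutSum-cong f≈g []      = f≈g [] []
    cutSum-cong f≈g (c ∷ F) = +-cong (f≈g [] (c ∷ F)) (cutSum-cong (λ G H → f≈g (c ∷ G) H) F)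

    cutSum-zero : ∀ {n} (F : Array n k) → cutSum (λ _ _ → 0#) F ≈ 0#
    cutSum-zero []      = ≈-refl
    cutSum-zero (c ∷ F) = ≈-trans (+-identityˡ _) (cutSum-zero F)

    *-distribˡ-cutSum : ∀ a (f : ∀ {i j} → Array i k → Array j k → Carrier) {n} (F : Array n k) →
      a · cutSum f F ≈ cutSum (λ G H → a · f G H) F
    *-distribˡ-cutSum a f []      = ≈-refl
    *-distribˡ-cutSum a f (c ∷ F) = ≈-trans (distribˡ a _ _)
      (+-congˡ (*-distribˡ-cutSum a (λ G H → f (c ∷ G) H) F))

    -- The sum of f G H over all pairs of fillings G with i columns and H with j columns
    -- whose label sets split xs.
    splitSum : List ℕ → ∀ i j → (Array i k → Array j k → Carrier) → Carrier
    splitSum xs i j f = sumOver (splits xs) λ (ys , zs) →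
      sumOver (arrangements i k ys) λ G → sumOver (arrangements j k zs) λ H → f G H

    -- Splitting off the labels of a column c and then dividing the rest between G and H
    -- is the same as dividing the labels between c ∷ G and H.
    splitSum-suc : ∀ i j (f : Array (suc i) k → Array j k → Carrier) xs →
      sumOver (splits xs) (λ (ys , zs) → sumOver (columns k ys) λ c →
        splitSum zs i j λ G H → f (c ∷ G) H) ≈
      splitSum xs (suc i) j f
    splitSum-suc i j f xs = begin
      (sumOver (splits xs) λ (as , bs) → sumOver (columns k as) λ c →
        sumOver (splits bs) λ (cs , ds) → sumOver (arrangements i k cs) λ G →
        sumOver (arrangements j k ds) λ H → f (c ∷ G) H)
        ≈⟨ sumOver-cong (splits xs) (λ (as , bs) → sumOver-comm _ (columns k as) (splits bs)) ⟩
      (sumOver (splits xs) λ (as , bs) → sumOver (splits bs) λ (cs , ds) →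
        sumOver (columns k as) λ c → sumOver (arrangements i k cs) λ G →
        sumOver (arrangements j k ds) λ H → f (c ∷ G) H)
        ≈⟨ sumOver-splits-assoc (λ as cs ds → sumOver (columns k as) λ c →
             sumOver (arrangements i k cs) λ G → sumOver (arrangements j k ds) λ H →
             f (c ∷ G) H) xs ⟩
      (sumOver (splits xs) λ (es , ds) → sumOver (splits es) λ (as , cs) →
        sumOver (columns k as) λ c → sumOver (arrangements i k cs) λ G →
        sumOver (arrangements j k ds) λ H → f (c ∷ G) H)
        ≈⟨ sumOver-cong (splits xs) (λ (es , ds) → sumOver-arrangements-suc _ es) ⟨
      splitSum xs (suc i) j f ∎

    -- Cutting a filling after i columns amounts to splitting its label set and
    -- filling both parts.  In the second form the left part has one more column c,
    -- so that it is nonempty.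
    sumOver-cutSum : ∀ n (f : ∀ {i j} → Array i k → Array j k → Carrier) xs →
      sumOver (arrangements n k xs) (cutSum f) ≈
      sum {suc n} λ i → splitSum xs (toℕ i) (n ∸ toℕ i) f
    sumOver-cutSum-suc : ∀ n (f : ∀ {i j} → Array (suc i) k → Array j k → Carrier) xs →
      sumOver (splits xs) (λ (ys , zs) → sumOver (columns k ys) λ c →
        sumOver (arrangements n k zs) (cutSum λ G H → f (c ∷ G) H)) ≈
      sum {suc n} λ i → splitSum xs (suc (toℕ i)) (n ∸ toℕ i) f

    sumOver-cutSum zero f xs = begin
      sumOver (arrangements 0 k xs) (cutSum f)
        ≈⟨ sumOver-cong (arrangements 0 k xs) (λ { [] → ≈-refl }) ⟩
      sumOver (arrangements 0 k xs) (f [])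
        ≈⟨ sumOver-splits-identityˡ (λ G zs → sumOver (arrangements 0 k zs) (f G)) xs ⟨
      splitSum xs 0 0 f
        ≈⟨ +-identityʳ _ ⟨
      splitSum xs 0 0 f + 0# ∎
    sumOver-cutSum (suc n) f xs = begin
      sumOver (arrangements (suc n) k xs) (cutSum f)
        ≈⟨ sumOver-cong (arrangements (suc n) k xs) (λ { (c ∷ F) → ≈-refl }) ⟩
      sumOver (arrangements (suc n) k xs) (λ F → f [] F + rest F)
        ≈⟨ sumOver-+ _ _ (arrangements (suc n) k xs) ⟩
      sumOver (arrangements (suc n) k xs) (f []) + sumOver (arrangements (suc n) k xs) rest
        ≈⟨ +-cong (≈-sym (sumOver-splits-identityˡ (λ G zs → sumOver (arrangements (suc n) k zs) (f G)) xs))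
                  (≈-trans (sumOver-arrangements-suc rest xs) (sumOver-cutSum-suc n f xs)) ⟩
      splitSum xs 0 (suc n) f + (sum {suc n} λ i → splitSum xs (suc (toℕ i)) (n ∸ toℕ i) f) ∎
      where
      rest : Array (suc n) k → Carrier
      rest (c ∷ F) = cutSum (λ G H → f (c ∷ G) H) F

    sumOver-cutSum-suc n f xs = begin
      (sumOver (splits xs) λ (ys , zs) → sumOver (columns k ys) λ c →
        sumOver (arrangements n k zs) (cutSum λ G H → f (c ∷ G) H))
        ≈⟨ sumOver-cong (splits xs) (λ (ys , zs) → ≈-trans
             (sumOver-cong (columns k ys) λ c → sumOver-cutSum n (λ G H → f (c ∷ G) H) zs)
             (sumOver-sum-comm {n = suc n} (λ c → part c zs) (columns k ys))) ⟩
      (sumOver (splits xs) λ (ys , zs) → sum {suc n} λ i → sumOver (columns k ys) λ c →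
        splitSum zs (toℕ i) (n ∸ toℕ i) λ G H → f (c ∷ G) H)
        ≈⟨ sumOver-sum-comm {n = suc n} (λ (ys , zs) i → sumOver (columns k ys) λ c → part c zs i)
             (splits xs) ⟩
      (sum {suc n} λ i → sumOver (splits xs) λ (ys , zs) → sumOver (columns k ys) λ c →
        splitSum zs (toℕ i) (n ∸ toℕ i) λ G H → f (c ∷ G) H)
        ≈⟨ sum-cong-≋ {suc n} (λ i → splitSum-suc (toℕ i) (n ∸ toℕ i) f xs) ⟩
      (sum {suc n} λ i → splitSum xs (suc (toℕ i)) (n ∸ toℕ i) f) ∎
      where
      part : Vec ℕ k → List ℕ → Fin (suc n) → Carrier
      part c zs i = splitSum zs (toℕ i) (n ∸ toℕ i) λ G H → f (c ∷ G) H

-- The recurrence for the coefficients of D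

-- R is a commutative ring with a homomorphism fromℕ from the naturals and inverses of
-- the factorials, and x is an element of R.
module Recurrence {r ℓr} (R : CommutativeRing r ℓr)
  (fromℕ : ℕ → CommutativeRing.Carrier R)
  (fromℕ-isHomomorphism : SemiringMorphisms.IsSemiringHomomorphism ℕ.+-*-rawSemiring
    (Semiring.rawSemiring (CommutativeRing.semiring R)) fromℕ)
  (1/_! : ℕ → CommutativeRing.Carrier R)
  (n!*1/n! : ∀ n → CommutativeRing._≈_ R (CommutativeRing._*_ R (fromℕ (n !)) 1/ n !)
    (CommutativeRing.1# R))
  {k ℓ} {Υ : Pred (Array 2 k) ℓ} (Υ? : Decidable Υ) (x : CommutativeRing.Carrier R) where

  open import Data.Nat.Base using (_*_)

  open CommutativeRing R hiding (zero) renaming (refl to ≈-refl; sym to ≈-sym; trans to ≈-trans; _*_ to _·_)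
  open import Relation.Binary.Reasoning.Setoid setoid
  open import Algebra.Properties.CommutativeMonoid.Sum +-commutativeMonoid
    using (sum; sum-cong-≋)
  open import Algebra.Properties.Semiring.Sum semiring using (*-distribˡ-sum)
  open import Algebra.Definitions.RawSemiring (Semiring.rawSemiring semiring) using (_^_)
  open SemiringMorphisms.IsSemiringHomomorphism fromℕ-isHomomorphism
    using (+-homo; *-homo; 0#-homo; 1#-homo)
  open SemiringSolver commutativeSemiring
  open FiniteSums R
  open Matches Υ?

  sumOver-if : ∀ {p} {A : Set} {P : Pred A p} (P? : Decidable P) c xs →
    sumOver xs (λ a → if does (P? a) then c else 0#) ≈ fromℕ (length (filter P? xs)) · c
  sumOver-if P? c [] = ≈-sym (≈-trans (*-congʳ 0#-homo) (zeroˡ c))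
  sumOver-if P? c (a ∷ xs) with does (P? a)
  ... | false = ≈-trans (+-identityˡ _) (sumOver-if P? c xs)
  ... | true  = begin
    c + sumOver xs (λ a → if does (P? a) then c else 0#)   ≈⟨ +-cong (≈-sym (*-identityˡ c)) (sumOver-if P? c xs) ⟩
    1# · c + fromℕ (length (filter P? xs)) · c             ≈⟨ distribʳ c _ _ ⟨
    (1# + fromℕ (length (filter P? xs))) · c               ≈⟨ *-congʳ (+-congʳ 1#-homo) ⟨
    (fromℕ 1 + fromℕ (length (filter P? xs))) · c          ≈⟨ *-congʳ (+-homo 1 _) ⟨
    fromℕ (suc (length (filter P? xs))) · c                ∎

  sumOver-sumOver-· : ∀ {A B : Set} a (f : A → Carrier) (g : B → Carrier) xs ys →
    sumOver xs (λ u → sumOver ys λ v → a · f u · g v) ≈ a · sumOver xs f · sumOver ys g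
  sumOver-sumOver-· a f g xs ys = begin
    sumOver xs (λ u → sumOver ys λ v → a · f u · g v)   ≈⟨ sumOver-cong xs (λ u → *-distribˡ-sumOver (a · f u) g ys) ⟨
    sumOver xs (λ u → a · f u · sumOver ys g)           ≈⟨ *-distribʳ-sumOver _ _ xs ⟨
    sumOver xs (λ u → a · f u) · sumOver ys g           ≈⟨ *-congʳ (*-distribˡ-sumOver a f xs) ⟨
    a · sumOver xs f · sumOver ys g                     ∎

  choose/! : ∀ m n → fromℕ ((m ℕ.+ n) C m) · 1/ (m ℕ.+ n) ! ≈ 1/ m ! · 1/ n !
  choose/! m n = begin
    c · N⁻¹                                                   ≈⟨ *-identityʳ _ ⟨
    c · N⁻¹ · 1#                                              ≈⟨ *-congˡ (*-identityˡ 1#) ⟨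
    c · N⁻¹ · (1# · 1#)                                       ≈⟨ *-congˡ (*-cong (n!*1/n! m) (n!*1/n! n)) ⟨
    c · N⁻¹ · ((fromℕ (m !) · 1/ m !) · (fromℕ (n !) · 1/ n !))
      ≈⟨ solve 6 (λ c N⁻¹ m m⁻¹ n n⁻¹ → c :* N⁻¹ :* ((m :* m⁻¹) :* (n :* n⁻¹)) :=
                                        c :* (m :* n) :* N⁻¹ :* (m⁻¹ :* n⁻¹)) ≈-refl
           c N⁻¹ (fromℕ (m !)) (1/ m !) (fromℕ (n !)) (1/ n !) ⟩
    c · (fromℕ (m !) · fromℕ (n !)) · N⁻¹ · (1/ m ! · 1/ n !)
      ≈⟨ *-congʳ (*-congʳ (≈-trans (*-homo _ _) (*-congˡ (*-homo _ _)))) ⟨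
    fromℕ (((m ℕ.+ n) C m) * (m ! * n !)) · N⁻¹ · (1/ m ! · 1/ n !)
      ≡⟨ cong (λ j → fromℕ j · N⁻¹ · (1/ m ! · 1/ n !)) ([m+n]Cm*m!*n!≡[m+n]! m n) ⟩
    fromℕ ((m ℕ.+ n) !) · N⁻¹ · (1/ m ! · 1/ n !)             ≈⟨ *-congʳ (n!*1/n! (m ℕ.+ n)) ⟩
    1# · (1/ m ! · 1/ n !)                                    ≈⟨ *-identityˡ _ ⟩
    1/ m ! · 1/ n !                                           ∎
    where
    c   = fromℕ ((m ℕ.+ n) C m)
    N⁻¹ = 1/ (m ℕ.+ n) !

  y : Carrier
  y = x - 1#

  -- The weight x^mch of an array, which is 1 for the array with no columns.
  weight : ∀ {n} → Array n k → Carrier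
  weight {zero}  _ = 1#
  weight {suc m} F = x ^ mch Υ? F

  -- The indicator of the arrays with a match at every position.
  allMatch : ∀ {m} → Array (suc m) k → Carrier
  allMatch {m} F = if does (mch Υ? F ℕ.≟ m) then 1# else 0#

  allMatch-∷ : ∀ {m} c d (F : Array m k) →
    allMatch (c ∷ d ∷ F) ≈ (if match c d then allMatch (d ∷ F) else 0#)
  allMatch-∷ {m} c d F rewrite mch-∷ c d F with match c d
  ... | true  = ≈-refl
  ... | false rewrite dec-false (mch Υ? (d ∷ F) ℕ.≟ suc m)
                        (λ eq → ℕ.<-irrefl eq (s≤s (mch-≤ (d ∷ F)))) = ≈-refl

  -- The first column c is fixed, and the array F of the others is cut into G and H; the
  -- exponent i is the number of positions of c ∷ G.
  weight-cutSum : ∀ {m} c (F : Array m k) →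
    weight (c ∷ F) ≈ cutSum (λ {i} G H → y ^ i · allMatch (c ∷ G) · weight H) F
  weight-cutSum c [] = ≈-sym (≈-trans (*-identityʳ _) (*-identityʳ _))
  weight-cutSum {suc m} c (d ∷ F) = begin
    weight (c ∷ d ∷ F)
      ≈⟨ step (match c d) (mch-∷ c d F) (allMatch-∷ c d) ⟩
    weight (d ∷ F) + cutSum (λ {i} G H → y ^ suc i · allMatch (c ∷ d ∷ G) · weight H) F
      ≈⟨ +-congʳ (≈-trans (*-congʳ (*-identityʳ _)) (*-identityˡ _)) ⟨
    cutSum (λ {i} G H → y ^ i · allMatch (c ∷ G) · weight H) (d ∷ F) ∎
    where
    step : ∀ b → mch Υ? (c ∷ d ∷ F) ≡ (if b then suc (mch Υ? (d ∷ F)) else mch Υ? (d ∷ F)) →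
      (∀ {i} (G : Array i k) → allMatch (c ∷ d ∷ G) ≈ (if b then allMatch (d ∷ G) else 0#)) →
      weight (c ∷ d ∷ F) ≈
      weight (d ∷ F) + cutSum (λ {i} G H → y ^ suc i · allMatch (c ∷ d ∷ G) · weight H) F
    step false eq am = begin
      x ^ mch Υ? (c ∷ d ∷ F)   ≡⟨ cong (x ^_) eq ⟩
      weight (d ∷ F)           ≈⟨ +-identityʳ _ ⟨
      weight (d ∷ F) + 0#      ≈⟨ +-congˡ (≈-sym (cutSum-zero F)) ⟩
      weight (d ∷ F) + cutSum (λ _ _ → 0#) F
        ≈⟨ +-congˡ (cutSum-cong (λ G H → ≈-trans (*-congʳ (≈-trans (*-congˡ (am G)) (zeroʳ _))) (zeroˡ _)) F) ⟨
      weight (d ∷ F) + cutSum (λ {i} G H → y ^ suc i · allMatch (c ∷ d ∷ G) · weight H) F ∎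
    step true eq am = begin
      x ^ mch Υ? (c ∷ d ∷ F)                 ≡⟨ cong (x ^_) eq ⟩
      x · weight (d ∷ F)                     ≈⟨ *-congʳ x≈1+y ⟩
      (1# + y) · weight (d ∷ F)              ≈⟨ distribʳ _ 1# y ⟩
      1# · weight (d ∷ F) + y · weight (d ∷ F)
        ≈⟨ +-cong (*-identityˡ _) (*-congˡ (weight-cutSum d F)) ⟩
      weight (d ∷ F) + y · cutSum (λ {i} G H → y ^ i · allMatch (d ∷ G) · weight H) F
        ≈⟨ +-congˡ (*-distribˡ-cutSum y _ F) ⟩
      weight (d ∷ F) + cutSum (λ {i} G H → y · (y ^ i · allMatch (d ∷ G) · weight H)) F
        ≈⟨ +-congˡ (cutSum-cong (λ {i} G H → ≈-trans (≈-sym (*-assoc _ _ _))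
             (*-congʳ (≈-trans (≈-sym (*-assoc _ _ _)) (*-congˡ (≈-sym (am G)))))) F) ⟩
      weight (d ∷ F) + cutSum (λ {i} G H → y ^ suc i · allMatch (c ∷ d ∷ G) · weight H) F ∎
      where
      x≈1+y : x ≈ 1# + (x - 1#)
      x≈1+y = ≈-sym (≈-trans (+-comm 1# y) (≈-trans (+-assoc x (- 1#) 1#)
                (≈-trans (+-congˡ (-‿inverseˡ 1#)) (+-identityʳ x))))

  weight-invariant : ∀ {n} → Invariant (weight {n})
  weight-invariant {zero}  mono F = ≈-refl
  weight-invariant {suc m} mono F = reflexive (cong (x ^_) (mch-relabel mono F))

  allMatch-invariant : ∀ {m} → Invariant (allMatch {m})
  allMatch-invariant {m} mono F =
    reflexive (cong (λ j → if does (j ℕ.≟ m) then 1# else 0#) (mch-relabel mono F))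

  -- The sum of the weights of all fillings with n columns.
  totalWeight : ℕ → Carrier
  totalWeight n = sumOver (arrangements n k [1⋯ k * n ]) weight

  totalWeight-zero : totalWeight 0 ≈ 1#
  totalWeight-zero rewrite ℕ.*-zeroʳ k = +-identityʳ 1#

  sumOver-columns-one : ∀ j (xs : List ℕ) → length xs ≡ j → sumOver (columns j xs) (λ _ → 1#) ≈ 1#
  sumOver-columns-one zero    []       eq = +-identityʳ 1#
  sumOver-columns-one (suc j) (x ∷ xs) eq =
    ≈-trans (sumOver-map (λ _ → 1#) (x ∷_) (columns j xs))
            (sumOver-columns-one j xs (ℕ.suc-injective eq))

  length-[1⋯] : ∀ N → length [1⋯ N ] ≡ N
  length-[1⋯] N = trans (List.length-map suc (upTo N)) (List.length-upTo N)

  -- For one column, `full` is 1 by convention; this agrees with the count, since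
  -- the only filling has its labels in increasing order.
  sumOver-allMatch : ∀ m → sumOver (arrangements (suc m) k [1⋯ k * suc m ]) allMatch ≈
                           fromℕ (full Υ? (suc m))
  sumOver-allMatch zero = begin
    sumOver (arrangements 1 k xs) allMatch
      ≈⟨ sumOver-arrangements-suc allMatch xs ⟩
    (sumOver (splits xs) λ (ys , zs) → sumOver (columns k ys) λ c →
      sumOver (arrangements 0 k zs) λ F → allMatch (c ∷ F))
      ≈⟨ sumOver-cong (splits xs) (λ (ys , zs) →
           sumOver-comm _ (columns k ys) (arrangements 0 k zs)) ⟩
    (sumOver (splits xs) λ (ys , zs) → sumOver (arrangements 0 k zs) λ F →
      sumOver (columns k ys) λ c → allMatch (c ∷ F))
      ≈⟨ sumOver-splits-identityʳ (λ ys F → sumOver (columns k ys) λ c → allMatch (c ∷ F)) xs ⟩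
    sumOver (columns k xs) (λ _ → 1#)
      ≈⟨ sumOver-columns-one k xs (trans (length-[1⋯] (k * 1)) (ℕ.*-identityʳ k)) ⟩
    1#        ≈⟨ 1#-homo ⟨
    fromℕ 1   ∎
    where xs = [1⋯ k * 1 ]
  sumOver-allMatch (suc m) = begin
    sumOver (arrangements (suc (suc m)) k [1⋯ k * suc (suc m) ]) allMatch
      ≈⟨ sumOver-↭ allMatch (𝓕-↭-arrangements (suc (suc m)) k) ⟨
    sumOver (𝓕 (suc (suc m)) k) allMatch
      ≈⟨ sumOver-if (λ F → mch Υ? F ℕ.≟ suc m) 1# (𝓕 (suc (suc m)) k) ⟩
    fromℕ (full Υ? (suc (suc m))) · 1#                  ≈⟨ *-identityʳ _ ⟩
    fromℕ (full Υ? (suc (suc m)))                       ∎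

  -- A splitting contributes nothing unless its first part has k * suc i labels, and
  -- all splittings with that property contribute the same amount.
  splitSum-product : ∀ N i j → k * suc i ℕ.+ k * j ≡ N →
    splitSum [1⋯ N ] (suc i) j (λ G H → y ^ i · allMatch G · weight H) ≈
    fromℕ (N C (k * suc i)) · (y ^ i · fromℕ (full Υ? (suc i)) · totalWeight j)
  splitSum-product N i j eq = begin
    splitSum [1⋯ N ] (suc i) j (λ G H → y ^ i · allMatch G · weight H)
      ≈⟨ sumOver-cong-∈ (splits [1⋯ N ]) (λ {s} s∈ → piece s s∈ (hasSize? (k * suc i) s)) ⟩
    sumOver (splits [1⋯ N ]) (λ s → if does (hasSize? (k * suc i) s) then c else 0#)
      ≈⟨ sumOver-if (hasSize? (k * suc i)) c (splits [1⋯ N ]) ⟩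
    fromℕ (length (filter (hasSize? (k * suc i)) (splits [1⋯ N ]))) · c
      ≡⟨ cong (λ l → fromℕ l · c) (trans (count-splits (k * suc i) [1⋯ N ])
           (cong (_C (k * suc i)) (length-[1⋯] N))) ⟩
    fromℕ (N C (k * suc i)) · c ∎
    where
    c = y ^ i · fromℕ (full Υ? (suc i)) · totalWeight j
    product : List ℕ × List ℕ → Carrier
    product (ys , zs) = sumOver (arrangements (suc i) k ys) λ G →
      sumOver (arrangements j k zs) λ H → y ^ i · allMatch G · weight H
    piece : ∀ s → s ∈ splits [1⋯ N ] → (size? : Dec (length (proj₁ s) ≡ k * suc i)) →
            product s ≈ (if does size? then c else 0#)
    piece (ys , zs) s∈ (no |ys|≢) =
      reflexive (cong (λ Gs → sumOver Gs _) (arrangements-empty {suc i} ys |ys|≢))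
    piece (ys , zs) s∈ (yes |ys|≡) = begin
      product (ys , zs)
        ≈⟨ sumOver-sumOver-· (y ^ i) allMatch weight (arrangements (suc i) k ys) (arrangements j k zs) ⟩
      y ^ i · sumOver (arrangements (suc i) k ys) allMatch · sumOver (arrangements j k zs) weight
        ≈⟨ *-cong (*-congˡ (sumOver-arrangements-invariant allMatch allMatch-invariant ys↗))
                  (sumOver-arrangements-invariant {k} {j} weight weight-invariant zs↗) ⟩
      y ^ i · sumOver (arrangements (suc i) k [1⋯ length ys ]) allMatch
            · sumOver (arrangements j k [1⋯ length zs ]) weight
        ≡⟨ cong₂ (λ p q → y ^ i · sumOver (arrangements (suc i) k [1⋯ p ]) allMatch
                                · sumOver (arrangements j k [1⋯ q ]) weight) |ys|≡ |zs|≡ ⟩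
      y ^ i · sumOver (arrangements (suc i) k [1⋯ k * suc i ]) allMatch · totalWeight j
        ≈⟨ *-congʳ (*-congˡ (sumOver-allMatch i)) ⟩
      c ∎
      where
      sorted = splits-AllPairs {xs = [1⋯ N ]} s∈ ([1⋯]-Sorted N)
      ys↗ = proj₁ sorted
      zs↗ = proj₂ sorted
      |zs|≡ : length zs ≡ k * j
      |zs|≡ = ℕ.+-cancelˡ-≡ (k * suc i) (length zs) (k * j) (trans (cong (ℕ._+ length zs) (sym |ys|≡))
             (trans (splits-length {xs = [1⋯ N ]} s∈) (trans (length-[1⋯] N) (sym eq))))

  block-size : ∀ n (i : Fin (suc n)) → k * suc (toℕ i) ℕ.+ k * (n ∸ toℕ i) ≡ k * suc n
  block-size n i = trans (sym (ℕ.*-distribˡ-+ k (suc (toℕ i)) (n ∸ toℕ i)))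
    (cong (λ j → k * suc j) (ℕ.m+[n∸m]≡n (Fin.toℕ≤pred[n] i)))

  -- The i-th term of the recurrence, for an initial block of i + 1 columns.
  summand : ∀ n → Fin (suc n) → Carrier
  summand n i = fromℕ ((k * suc n) C (k * suc (toℕ i))) ·
    (y ^ toℕ i · fromℕ (full Υ? (suc (toℕ i))) · totalWeight (n ∸ toℕ i))

  totalWeight-suc : ∀ n → totalWeight (suc n) ≈ sum (summand n)
  totalWeight-suc n = begin
    sumOver (arrangements (suc n) k xs) weight
      ≈⟨ sumOver-arrangements-suc weight xs ⟩
    (sumOver (splits xs) λ (ys , zs) → sumOver (columns k ys) λ c →
      sumOver (arrangements n k zs) λ F → weight (c ∷ F))
      ≈⟨ sumOver-cong (splits xs) (λ (ys , zs) → sumOver-cong (columns k ys) λ c →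
           sumOver-cong (arrangements n k zs) λ F → weight-cutSum c F) ⟩
    (sumOver (splits xs) λ (ys , zs) → sumOver (columns k ys) λ c →
      sumOver (arrangements n k zs) (cutSum λ {i} G H → y ^ i · allMatch (c ∷ G) · weight H))
      ≈⟨ sumOver-cutSum-suc n (λ {i} G H → y ^ i · allMatch G · weight H) xs ⟩
    (sum {suc n} λ i → splitSum xs (suc (toℕ i)) (n ∸ toℕ i) λ G H →
      y ^ toℕ i · allMatch G · weight H)
      ≈⟨ sum-cong-≋ {suc n} (λ i →
           splitSum-product (k * suc n) (toℕ i) (n ∸ toℕ i) (block-size n i)) ⟩
    sum (summand n) ∎
    where xs = [1⋯ k * suc n ]

  -- The coefficient of tⁿ in D.
  D-coeff : ℕ → Carrier
  D-coeff n = 1/ (k * n) ! · totalWeight n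

  D-coeff-suc : ∀ n → y · D-coeff (suc n) ≈ sum {suc n} λ i →
    (y ^ suc (toℕ i) · 1/ (k * suc (toℕ i)) ! · fromℕ (full Υ? (suc (toℕ i)))) · D-coeff (n ∸ toℕ i)
  D-coeff-suc n = begin
    y · (1/ (k * suc n) ! · totalWeight (suc n))      ≈⟨ *-assoc _ _ _ ⟨
    y · 1/ (k * suc n) ! · totalWeight (suc n)        ≈⟨ *-congˡ (totalWeight-suc n) ⟩
    y · 1/ (k * suc n) ! · sum (summand n)            ≈⟨ *-distribˡ-sum (y · 1/ (k * suc n) !) (summand n) ⟩
    (sum {suc n} λ i → y · 1/ (k * suc n) ! · summand n i)
                                                      ≈⟨ sum-cong-≋ {suc n} term ⟩
    (sum {suc n} λ i →
      (y ^ suc (toℕ i) · 1/ (k * suc (toℕ i)) ! · fromℕ (full Υ? (suc (toℕ i)))) · D-coeff (n ∸ toℕ i)) ∎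
    where
    term : ∀ i → y · 1/ (k * suc n) ! · summand n i ≈
           (y ^ suc (toℕ i) · 1/ (k * suc (toℕ i)) ! · fromℕ (full Υ? (suc (toℕ i)))) · D-coeff (n ∸ toℕ i)
    term i = begin
      y · 1/ (k * suc n) ! · (fromℕ ((k * suc n) C p) · (yⁱ · fₘ · w))
        ≡⟨ cong (λ N → y · 1/ N ! · (fromℕ (N C p) · (yⁱ · fₘ · w))) (block-size n i) ⟨
      y · 1/ (p ℕ.+ q) ! · (fromℕ ((p ℕ.+ q) C p) · (yⁱ · fₘ · w))
        ≈⟨ solve 6 (λ y N⁻¹ c yⁱ f w → y :* N⁻¹ :* (c :* (yⁱ :* f :* w)) :=
             (c :* N⁻¹) :* (y :* yⁱ :* f :* w)) ≈-refl y (1/ (p ℕ.+ q) !) (fromℕ ((p ℕ.+ q) C p)) yⁱ fₘ w ⟩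
      (fromℕ ((p ℕ.+ q) C p) · 1/ (p ℕ.+ q) !) · (y · yⁱ · fₘ · w)
        ≈⟨ *-congʳ (choose/! p q) ⟩
      (1/ p ! · 1/ q !) · (y · yⁱ · fₘ · w)
        ≈⟨ solve 6 (λ y p⁻¹ q⁻¹ yⁱ f w → (p⁻¹ :* q⁻¹) :* (y :* yⁱ :* f :* w) :=
             (y :* yⁱ :* p⁻¹ :* f) :* (q⁻¹ :* w)) ≈-refl y (1/ p !) (1/ q !) yⁱ fₘ w ⟩
      (y · yⁱ · 1/ p ! · fₘ) · (1/ q ! · w) ∎
      where
      p  = k * suc (toℕ i)
      q  = k * (n ∸ toℕ i)
      yⁱ = y ^ toℕ i
      fₘ = fromℕ (full Υ? (suc (toℕ i)))
      w  = totalWeight (n ∸ toℕ i)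

  D-coeff-zero : D-coeff 0 ≈ 1#
  D-coeff-zero = begin
    1/ (k * 0) ! · totalWeight 0   ≈⟨ *-congˡ totalWeight-zero ⟩
    1/ (k * 0) ! · 1#              ≈⟨ *-identityʳ _ ⟩
    1/ (k * 0) !                   ≡⟨ cong 1/_! (ℕ.*-zeroʳ k) ⟩
    1/ 0 !                         ≈⟨ *-identityˡ _ ⟨
    1# · 1/ 0 !                    ≈⟨ *-congʳ 1#-homo ⟨
    fromℕ 1 · 1/ 0 !               ≈⟨ n!*1/n! 0 ⟩
    1#                             ∎

  -- Here f and g stand for the coefficients of D and of the denominator of the
  -- quotient; the recurrence then says that f g is constant.
  module _ (f g : ℕ → Carrier)
    (f-zero : f 0 ≈ 1#)
    (f-suc : ∀ m → f (suc m) ≈ 1/ (k * suc m) ! · sumOver (𝓕 (suc m) k) weight)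
    (g-zero : g 0 ≈ 1# - x)
    (g-suc : ∀ m → g (suc m) ≈ y ^ suc m · 1/ (k * suc m) ! · fromℕ (full Υ? (suc m))) where

    f≈D-coeff : ∀ n → f n ≈ D-coeff n
    f≈D-coeff zero    = ≈-trans f-zero (≈-sym D-coeff-zero)
    f≈D-coeff (suc m) = ≈-trans (f-suc m) (*-congˡ (sumOver-↭ weight (𝓕-↭-arrangements (suc m) k)))

    g₀*f-suc : ∀ n → g 0 · f (suc n) ≈ - sum {suc n} λ i → g (suc (toℕ i)) · f (n ∸ toℕ i)
    g₀*f-suc n = begin
      g 0 · f (suc n)             ≈⟨ *-cong g-zero (f≈D-coeff (suc n)) ⟩
      (1# - x) · D-coeff (suc n)  ≈⟨ *-congʳ (⁻¹-anti-homo-// x 1#) ⟨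
      - y · D-coeff (suc n)       ≈⟨ -‿distribˡ-* y (D-coeff (suc n)) ⟨
      - (y · D-coeff (suc n))     ≈⟨ -‿cong (D-coeff-suc n) ⟩
      - (sum {suc n} λ i →
          (y ^ suc (toℕ i) · 1/ (k * suc (toℕ i)) ! · fromℕ (full Υ? (suc (toℕ i)))) · D-coeff (n ∸ toℕ i))
        ≈⟨ -‿cong (sum-cong-≋ {suc n} λ i → *-cong (g-suc (toℕ i)) (f≈D-coeff (n ∸ toℕ i))) ⟨
      - (sum {suc n} λ i → g (suc (toℕ i)) · f (n ∸ toℕ i)) ∎
      where
      open RingProperties ring using (-‿distribˡ-*)
      open import Algebra.Properties.Group +-group using (⁻¹-anti-homo-//)


-- Quotients of power series

module SeriesQuotient {r ℓr} (R : CommutativeRing r ℓr) where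

  open CommutativeRing R hiding (zero) renaming (refl to ≈-refl; sym to ≈-sym; trans to ≈-trans; _*_ to _·_)
  open import Relation.Binary.Reasoning.Setoid setoid
  open import Algebra.Properties.CommutativeMonoid.Sum +-commutativeMonoid
    using (sum; sum-cong-≋; sum-replicate-zero)
  open import Algebra.Properties.Semiring.Sum semiring using (*-distribˡ-sum)
  open RingProperties ring using (-‿distribʳ-*)
  open CommSemigroupProperties *-commutativeSemigroup using (x∙yz≈y∙xz)

  -- A power series f with constant term 1 and g f = g 0 is the product h v of the
  -- constant h = g 0 with the inverse v of g.  Here w n lists the coefficients
  -- v n, …, v 0 from which v (suc n) is computed.
  quotient-unique : (h f g v : ℕ → Carrier) (w : ∀ n → Fin (suc n) → Carrier) →
    h 0 ≈ g 0 → (∀ m → h (suc m) ≈ 0#) →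
    (∀ n i → w n i ≡ v (n ∸ toℕ i)) →
    v 0 · g 0 ≈ 1# →
    (∀ n → v (suc n) ≈ - (v 0 · sum {suc n} λ i → g (suc (toℕ i)) · w n i)) →
    f 0 ≈ 1# →
    (∀ n → g 0 · f (suc n) ≈ - sum {suc n} λ i → g (suc (toℕ i)) · f (n ∸ toℕ i)) →
    ∀ n → f n ≈ sum {suc n} λ i → h (toℕ i) · v (n ∸ toℕ i)
  quotient-unique h f g v w h₀ h₊ w≡v v₀ v₊ f₀ f₊ n = begin
    f n                     ≈⟨ f≈g₀v n n ℕ.≤-refl ⟩
    g 0 · v n               ≈⟨ *-congʳ h₀ ⟨
    h 0 · v n               ≈⟨ +-identityʳ _ ⟨
    h 0 · v n + 0#          ≈⟨ +-congˡ (sum-replicate-zero n) ⟨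
    h 0 · v n + (sum {n} λ _ → 0#)
      ≈⟨ +-congˡ (sum-cong-≋ {n} λ i → ≈-trans (*-congʳ (h₊ (toℕ i))) (zeroˡ _)) ⟨
    (sum {suc n} λ i → h (toℕ i) · v (n ∸ toℕ i)) ∎
    where
    -- The bound N allows strong induction on n.
    f≈g₀v : ∀ N n → n ≤ N → f n ≈ g 0 · v n
    f≈g₀v N zero _ = ≈-trans f₀ (≈-sym (≈-trans (*-comm (g 0) (v 0)) v₀))
    f≈g₀v (suc N) (suc n) (s≤s n≤N) = begin
      f (suc n)                ≈⟨ *-identityˡ _ ⟨
      1# · f (suc n)           ≈⟨ *-congʳ v₀ ⟨
      v 0 · g 0 · f (suc n)    ≈⟨ *-assoc _ _ _ ⟩
      v 0 · (g 0 · f (suc n))  ≈⟨ *-congˡ (f₊ n) ⟩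
      v 0 · - (sum {suc n} λ i → g (suc (toℕ i)) · f (n ∸ toℕ i))
        ≈⟨ *-congˡ (-‿cong (sum-cong-≋ {suc n} λ i → begin
             g (suc (toℕ i)) · f (n ∸ toℕ i)
               ≈⟨ *-congˡ (f≈g₀v N (n ∸ toℕ i) (ℕ.≤-trans (ℕ.m∸n≤m n (toℕ i)) n≤N)) ⟩
             g (suc (toℕ i)) · (g 0 · v (n ∸ toℕ i))
               ≈⟨ x∙yz≈y∙xz _ _ _ ⟩
             g 0 · (g (suc (toℕ i)) · v (n ∸ toℕ i))
               ≡⟨ cong (λ u → g 0 · (g (suc (toℕ i)) · u)) (w≡v n i) ⟨
             g 0 · (g (suc (toℕ i)) · w n i) ∎)) ⟩
      v 0 · - (sum {suc n} λ i → g 0 · (g (suc (toℕ i)) · w n i))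
        ≈⟨ *-congˡ (-‿cong (*-distribˡ-sum {suc n} (g 0) (λ i → g (suc (toℕ i)) · w n i))) ⟨
      v 0 · - (g 0 · S)        ≈⟨ *-congˡ (-‿distribʳ-* _ _) ⟩
      v 0 · (g 0 · - S)        ≈⟨ x∙yz≈y∙xz _ _ _ ⟩
      g 0 · (v 0 · - S)        ≈⟨ *-congˡ (-‿distribʳ-* _ _) ⟨
      g 0 · - (v 0 · S)        ≈⟨ *-congˡ (v₊ n) ⟨
      g 0 · v (suc n)          ∎
      where S = sum {suc n} λ i → g (suc (toℕ i)) · w n i

-- The generating function

module K = CommutativeRing FractionField.commutativeRing

open ℚ⟨x⟩ using (sumOver; 0#; 1#; X; _-_; _*_; _^_; 1/_!; fromℕ; 1-X+0≉0)
open PowerSeries using (Series; inverseₛ; inverseCoeffs; constant; Σ≥1; _+_; _≈_; _/_⟨_⟩)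

lookup-inverseCoeffs : ∀ g g₀≉0 n i →
  Vec.lookup (inverseCoeffs g g₀≉0 n) i ≡ inverseₛ g g₀≉0 (n ∸ toℕ i)
lookup-inverseCoeffs g g₀≉0 zero    zero    = refl
lookup-inverseCoeffs g g₀≉0 (suc n) zero    = refl
lookup-inverseCoeffs g g₀≉0 (suc n) (suc i) = lookup-inverseCoeffs g g₀≉0 n i

theorem2 : ∀ {ℓ} (k : ℕ) .{{_ : NonZero k}} (Υ : Pred (Array 2 k) ℓ) (Υ? : Decidable Υ) →
    Υ ⊆ IsFilling →
    D Υ? ≈
    constant (1# - X) /
    (constant (1# - X) + Σ≥1 (λ n → (X - 1#) ^ n * 1/ (k ℕ.* n) ! * fromℕ (full Υ? n)))
    ⟨ 1-X+0≉0 ⟩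
theorem2 k Υ Υ? _ = quotient-unique (constant (1# - X)) (D Υ?) g (inverseₛ g 1-X+0≉0)
    (λ n → Vec.lookup (inverseCoeffs g 1-X+0≉0 n))
    (K.sym {g 0} {1# - X} g-zero) (λ _ → K.refl {0#})
    (lookup-inverseCoeffs g 1-X+0≉0)
    (FractionField.inverse-cancelˡ (g 0) 1-X+0≉0)
    (λ n → K.refl {inverseₛ g 1-X+0≉0 (suc n)})
    D-zero
    (g₀*f-suc (D Υ?) g D-zero D-suc g-zero g-suc)
  where
  open SeriesQuotient FractionField.commutativeRing using (quotient-unique)
  open Recurrence FractionField.commutativeRing
    fromℕ Constants.fromℕ-isHomomorphism 1/_! Constants.n!*1/n! Υ? X using (g₀*f-suc)
  g : Series
  g = constant (1# - X) + Σ≥1 (λ n → (X - 1#) ^ n * 1/ (k ℕ.* n) ! * fromℕ (full Υ? n))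
  D-zero : D Υ? 0 K.≈ 1#
  D-zero = K.+-identityʳ 1#
  g-zero : g 0 K.≈ 1# - X
  g-zero = K.+-identityʳ (1# - X)
  D-suc : ∀ m → D Υ? (suc m) K.≈ 1/ (k ℕ.* suc m) ! * sumOver (𝓕 (suc m) k) λ F → X ^ mch Υ? F
  D-suc m = K.+-identityˡ (1/ (k ℕ.* suc m) ! * sumOver (𝓕 (suc m) k) λ F → X ^ mch Υ? F)
  g-suc : ∀ m → g (suc m) K.≈ (X - 1#) ^ suc m * 1/ (k ℕ.* suc m) ! * fromℕ (full Υ? (suc m))
  g-suc m = K.+-identityˡ ((X - 1#) ^ suc m * 1/ (k ℕ.* suc m) ! * fromℕ (full Υ? (suc m)))
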